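{- Suppose the following statement (A) holds: for every $m\ge 1$ and all non-overlapping permutations $\pi,\tau\in\mathfrak{S}_m$ that are in standard form, if $\pi$ and $\tau$ are c-Wilf equivalent then $\pi_1=\tau_1$ and $\pi_m=\tau_m$. Then the following statement (B) holds: for every $m\ge 1$ and all permutations $\pi,\tau\in\mathfrak{S}_m$ in standard form, if $\pi$ and $\tau$ are strongly c-Wilf equivalent then $\pi_1=\tau_1$ and $\pi_m=\tau_m$.
   Context: $\mathfrak{S}_n$ is the symmetric group on $[n]$, permutations written $\sigma=\sigma_1\cdots\sigma_n$, and $\mathfrak{S}=\bigcup_{n\ge0}\mathfrak{S}_n$. The standardization $\operatorname{st}(w)$ of a word of distinct integers replaces its smallest entry by 1, the next smallest by 2, etc. For $\pi\in\mathfrak{S}_m$ and $\sigma\in\mathfrak{S}_n$, $\operatorname{Em}(\pi,\sigma)=\{i\in[n-m+1]:\operatorname{st}(\sigma_i\cdots\sigma_{i+m-1})=\pi\}$ and $\operatorname{em}(\pi,\sigma)=|\operatorname{Em}(\pi,\sigma)|$. Let $a^\pi_{n,k}$ be the number of $\sigma\in\mathfrak{S}_n$ with $\operatorname{em}(\pi,\sigma)=k$. Two permutations $\pi,\tau$ are c-Wilf equivalent if $a^\pi_{n,0}=a^\tau_{n,0}$ for all $n$, and strongly c-Wilf equivalent if $a^\pi_{n,k}=a^\tau_{n,k}$ for all $n,k$. The overlap set of $\pi\in\mathfrak{S}_m$ is $\mathcal{O}_\pi=\{i\in[m-1]:\operatorname{st}(\pi_{i+1}\cdots\pi_m)=\operatorname{st}(\pi_1\cdots\pi_{m-i})\}$;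 $\pi$ is non-overlapping if $\mathcal{O}_\pi=\{m-1\}$. A permutation $\pi\in\mathfrak{S}_m$ is in standard form if $\pi_1<\pi_m$ and $\pi_1+\pi_m\le m+1$. -}

module Defs where

open import Data.Nat.Base using (ℕ; zero; suc; _+_; _∸_; _≤_; _<_; NonZero)
import Data.Nat.Properties as ℕ
open import Data.Fin.Base using (Fin; zero; suc; toℕ; fromℕ; punchIn)
import Data.Fin.Properties as Fin
open import Data.Fin.Permutation
  using (Permutation′; _⟨$⟩ʳ_; _≈_; id; insert; remove; insert-remove; insert-punchIn)
open import Data.List.Base
  using (List; []; _∷_; map; filter; length; take; drop; tabulate; applyUpTo; allFin; cartesianProductWith)
open import Data.List.Properties using (≡-dec)
import Data.List.Membership.Setoid as Membership
import Data.List.Membership.Setoid.Properties as Membershipₚ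
open import Data.List.Membership.Propositional.Properties using (∈-allFin)
open import Data.List.Relation.Unary.All using ([])
open import Data.List.Relation.Unary.AllPairs using ([]; _∷_)
open import Data.List.Relation.Unary.Any using (here)
import Data.List.Relation.Unary.Unique.Setoid as Unique
import Data.List.Relation.Unary.Unique.Setoid.Properties as Uniqueₚ
open import Data.List.Relation.Unary.Unique.Propositional.Properties using (allFin⁺)
open import Data.Product.Base using (_×_; _,_)
open import Level using (0ℓ)
open import Relation.Binary.Bundles using (Setoid)
open import Relation.Binary.PropositionalEquality
  using (_≡_; refl; sym; trans; cong; setoid)

------------------------------------------------------------------------
-- Words and one-line notation

Word : Set
Word = List ℕ

-- σ₁ ⋯ σₙ with entries in {1, …, n}; Fin n is 0-based, hence the suc.
oneLine : ∀ {n} → Permutation′ n → Word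
oneLine σ = tabulate (λ i → suc (toℕ (σ ⟨$⟩ʳ i)))

infix 8 _[_⋯_]

-- The factor wᵢ wᵢ₊₁ ⋯ wⱼ, with positions counted from 1.
_[_⋯_] : Word → ℕ → ℕ → Word
w [ i ⋯ j ] = drop (i ∸ 1) (take j w)

-- For a word of distinct entries, the r-th smallest entry x is the one
-- for which exactly r entries of the word are ≤ x.
st : Word → Word
st w = map (λ x → length (filter (ℕ._≤? x) w)) w

-- 1 ∷ 2 ∷ ⋯ ∷ n ∷ []
[1⋯_] : ℕ → List ℕ
[1⋯ n ] = applyUpTo suc n

infix 4 _≟ʷ_
_≟ʷ_ = ≡-dec ℕ._≟_

------------------------------------------------------------------------
-- Occurrences of consecutive patterns

-- The set is given by the increasing list of its elements.
-- suc n ∸ m is n - m + 1, truncated to 0 when m > n + 1.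
Em : ∀ {m n} → Permutation′ m → Permutation′ n → List ℕ
Em {m} {n} π σ =
  filter (λ i → st (oneLine σ [ i ⋯ i + m ∸ 1 ]) ≟ʷ oneLine π) [1⋯ suc n ∸ m ]

em : ∀ {m n} → Permutation′ m → Permutation′ n → ℕ
em π σ = length (Em π σ)

-- Every element of the symmetric group exactly once, up to pointwise
-- equality of the underlying functions (see the two lemmas at the end).
permutations : ∀ n → List (Permutation′ n)
permutations zero    = id ∷ []
permutations (suc n) =
  cartesianProductWith (insert zero) (allFin (suc n)) (permutations n)

-- a π n k is the number a^π_{n,k}.
a : ∀ {m} → Permutation′ m → ℕ → ℕ → ℕ
a π n k = length (filter (λ σ → em π σ ℕ.≟ k) (permutations n))

CWilfEquivalent : ∀ {m m′} → Permutation′ m → Permutation′ m′ → Set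
CWilfEquivalent π τ = ∀ n → a π n 0 ≡ a τ n 0

StronglyCWilfEquivalent : ∀ {m m′} → Permutation′ m → Permutation′ m′ → Set
StronglyCWilfEquivalent π τ = ∀ n k → a π n k ≡ a τ n k

------------------------------------------------------------------------
-- Overlaps and standard form

-- Again an increasing list of elements.
overlapSet : ∀ {m} → Permutation′ m → List ℕ
overlapSet {m} π =
  filter (λ i → st (oneLine π [ suc i ⋯ m ]) ≟ʷ st (oneLine π [ 1 ⋯ m ∸ i ])) [1⋯ m ∸ 1 ]

NonOverlapping : ∀ {m} → Permutation′ m → Set
NonOverlapping {m} π = overlapSet π ≡ m ∸ 1 ∷ []

-- π₁ and πₘ, again with values in {1, …, m}.
firstEntry lastEntry : ∀ {m} .{{_ : NonZero m}} → Permutation′ m → ℕ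
firstEntry {suc _} π = suc (toℕ (π ⟨$⟩ʳ zero))
lastEntry  {suc m} π = suc (toℕ (π ⟨$⟩ʳ fromℕ m))

StandardForm : ∀ {m} .{{_ : NonZero m}} → Permutation′ m → Set
StandardForm {m} π =
  firstEntry π < lastEntry π × firstEntry π + lastEntry π ≤ m + 1

------------------------------------------------------------------------
-- Correctness of the enumeration of permutations

permutationSetoid : ℕ → Setoid 0ℓ 0ℓ
permutationSetoid n = record
  { Carrier       = Permutation′ n
  ; _≈_           = _≈_
  ; isEquivalence = record
    { refl  = λ _ → refl
    ; sym   = λ p i → sym (p i)
    ; trans = λ p q i → trans (p i) (q i)
    }
  }

private
  insert-cong : ∀ {n} {j k : Fin (suc n)} {ρ σ : Permutation′ n} →
                j ≡ k → ρ ≈ σ → insert zero j ρ ≈ insert zero k σ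
  insert-cong         refl ρ≈σ zero    = refl
  insert-cong {j = j} refl ρ≈σ (suc i) = cong (punchIn j) (ρ≈σ i)

  insert-injective : ∀ {n} {j k : Fin (suc n)} {ρ σ : Permutation′ n} →
                     insert zero j ρ ≈ insert zero k σ → j ≡ k × ρ ≈ σ
  insert-injective {j = j} p with p zero
  ... | refl = refl , λ i → Fin.punchIn-injective j _ _ (p (suc i))

permutations-complete : ∀ n (π : Permutation′ n) →
  let open Membership (permutationSetoid n) in π ∈ permutations n
permutations-complete zero    π = here λ ()
permutations-complete (suc n) π =
  Membershipₚ.∈-resp-≈ (permutationSetoid (suc n))
    {x = insert zero (π ⟨$⟩ʳ zero) (remove zero π)} {y = π} (insert-remove zero π)
    (Membershipₚ.∈-cartesianProductWith⁺
      (setoid (Fin (suc n))) (permutationSetoid n) (permutationSetoid (suc n))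
      (λ {j} {k} {ρ} {σ} → insert-cong {ρ = ρ} {σ})
      (∈-allFin (π ⟨$⟩ʳ zero))
      (permutations-complete n (remove zero π)))

permutations-unique : ∀ n → Unique.Unique (permutationSetoid n) (permutations n)
permutations-unique zero    = [] ∷ []
permutations-unique (suc n) =
  Uniqueₚ.cartesianProductWith⁺
    (setoid (Fin (suc n))) (permutationSetoid n) (permutationSetoid (suc n))
    (insert zero)
    (λ {j} {k} {ρ} {σ} → insert-injective {ρ = ρ} {σ})
    (allFin⁺ (suc n)) (permutations-unique n)

{-# OPTIONS --safe #-}

-- The cluster method. Marking occurrences of π with weight t gives Σ_σ (1 + t)^em(π, σ), so strong
-- c-Wilf equivalence fixes the weighted number of marked permutations, and c-Wilf equivalence is the
-- case t = -1. A marked permutation splits into clusters of overlapping windows, and the entries of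
-- disjoint blocks of positions are independent, so the cluster numbers determine and are determined
-- by these weighted numbers. With m = M + 1, k windows that form a cluster on kM + 1 positions must
-- be chained, each sharing exactly one position with the next; the number of such chains is thus an
-- invariant of strong c-Wilf equivalence, and it depends only on π₁ and πₘ. A non-overlapping
-- permutation has no other clusters. Hence a non-overlapping permutation with the same end entries
-- as π carries the same information, and (A) applies to it. Such a permutation exists unless
-- (π₁, πₘ) is (1, m), or (2, 3) with m = 4; chains of two windows recognise these two cases.

module Submission where

open import Defs
open import Data.Bool.Base using (Bool; true; false; T; if_then_else_)
open import Data.Nat.Base
import Data.Bool.Properties as Bool
import Data.Nat.Properties as ℕ
open import Data.Integer.Base using (ℤ; 0ℤ; 1ℤ; -1ℤ; +≤+)
  renaming (+_ to pos; _+_ to _+ᶻ_; _*_ to _*ᶻ_; _-_ to _-ᶻ_; _≤_ to _≤ᶻ_; _^_ to _^ᶻ_; ∣_∣ to abs)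
import Data.Integer.Base as ℤ using (NonZero; ≢-nonZero)
import Data.Integer.Properties as ℤ
open import Algebra.Properties.AbelianGroup ℤ.+-0-abelianGroup using (∙-cancelˡ)
open import Algebra.Properties.CommutativeSemigroup ℤ.+-commutativeSemigroup
  using () renaming (interchange to +-interchange)
open import Data.Integer.Tactic.RingSolver using (solve-∀)
open import Data.Fin.Base using (Fin; zero; suc; toℕ; fromℕ; fromℕ<; punchIn; punchOut; join; _↑ˡ_; _↑ʳ_)
import Data.Fin.Properties as Fin
open import Data.Fin.Permutation
  using (Permutation′; permutation; _⟨$⟩ʳ_; _⟨$⟩ˡ_; _≈_; id; flip; _∘ₚ_; insert; inverseˡ; inverseʳ; insert-punchIn)
open import Data.List.Base hiding (sum)
import Data.List.Properties as List
import Data.List.Membership.Setoid as Membership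
open import Data.List.Relation.Unary.All as All using (All; []; _∷_)
import Data.List.Relation.Unary.All.Properties as All
open import Data.List.Relation.Unary.AllPairs using ([]; _∷_)
open import Data.List.Relation.Unary.Any using (here; there)
import Data.List.Relation.Unary.Unique.Setoid as Unique
open import Data.Product.Base using (_×_; _,_; ∃; ∃₂; proj₁; proj₂; Σ-syntax)
open import Data.Sum.Function.Propositional using (_⊎-↔_)
open import Function.Construct.Composition using (_↔-∘_)
open import Function.Construct.Symmetry using (↔-sym)
open import Data.Sum.Base as Sum using (_⊎_; inj₁; inj₂; [_,_]′)
open import Data.Empty using (⊥; ⊥-elim)
open import Data.Unit.Base using (⊤; tt)
open import Function.Base using (_∘_; case_of_)
open import Relation.Nullary using (¬_; Dec; yes; no; contradiction; does)
open import Relation.Nullary.Decidable using (map′; _×-dec_; dec-true; dec-false)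
open import Relation.Binary.Definitions using (tri<; tri≈; tri>)
open import Relation.Unary using (Decidable)
open import Relation.Binary.PropositionalEquality

-- Sums over permutations

-- Formal power series are avoided: all sums are taken at integers t, and a coefficient is recovered
-- by choosing t larger than the difference it has to detect. Since only relative order matters,
-- permutations are read as functions on ℕ up to order isomorphism, and windows become shifts of
-- such functions. The end entries alone determine the chain numbers because the last position of
-- one window is the first of the next: rearranging the interior of every window converts
-- occurrences of one pattern into occurrences of any other with the same ends. Both exceptions come
-- from overlaps of length 2. With ends 1 and m, where m ≥ 3, a pattern begins and ends with an
-- ascent; with ends 2 and 3 and m = 4 it is 2143 or 2413, whose first two and last two entries are
-- ordered alike. Two linked copies are determined by how their entries interleave below and above
-- the shared one. The ends 1 and m leave no freedom, all other ends in standard form leave some,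
-- and for m = 4 the ends 2 and 3 give 9 possibilities against 10 and 4.

∑ : {A : Set} → List A → (A → ℤ) → ℤ
∑ []       f = 0ℤ
∑ (x ∷ xs) f = f x +ᶻ ∑ xs f

∑-cong : ∀ {A : Set} (xs : List A) {f g : A → ℤ} → (∀ x → f x ≡ g x) → ∑ xs f ≡ ∑ xs g
∑-cong []       eq = refl
∑-cong (x ∷ xs) eq = cong₂ _+ᶻ_ (eq x) (∑-cong xs eq)

∑-zero : ∀ {A : Set} (xs : List A) → ∑ xs (λ _ → 0ℤ) ≡ 0ℤ
∑-zero []       = refl
∑-zero (x ∷ xs) = trans (ℤ.+-identityˡ _) (∑-zero xs)

∑-+ : ∀ {A : Set} (xs : List A) {f g : A → ℤ} → ∑ xs (λ x → f x +ᶻ g x) ≡ ∑ xs f +ᶻ ∑ xs g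
∑-+ []                   = refl
∑-+ (x ∷ xs) {f} {g} = trans (cong ((f x +ᶻ g x) +ᶻ_) (∑-+ xs)) (+-interchange (f x) (g x) (∑ xs f) (∑ xs g))

∑-*ˡ : ∀ {A : Set} c (xs : List A) {f : A → ℤ} → ∑ xs (λ x → c *ᶻ f x) ≡ c *ᶻ ∑ xs f
∑-*ˡ c []           = sym (ℤ.*-zeroʳ c)
∑-*ˡ c (x ∷ xs) {f} = trans (cong (c *ᶻ f x +ᶻ_) (∑-*ˡ c xs)) (sym (ℤ.*-distribˡ-+ c (f x) (∑ xs f)))

∑-*ʳ : ∀ {A : Set} c (xs : List A) {f : A → ℤ} → ∑ xs (λ x → f x *ᶻ c) ≡ ∑ xs f *ᶻ c
∑-*ʳ c xs {f} = trans (∑-cong xs λ x → ℤ.*-comm (f x) c) (trans (∑-*ˡ c xs) (ℤ.*-comm c (∑ xs f)))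

∑-swap : ∀ {A B : Set} (xs : List A) (ys : List B) {f : A → B → ℤ} →
         ∑ xs (λ x → ∑ ys (f x)) ≡ ∑ ys (λ y → ∑ xs (λ x → f x y))
∑-swap []       ys = sym (∑-zero ys)
∑-swap (x ∷ xs) ys {f} = trans (cong (∑ ys (f x) +ᶻ_) (∑-swap xs ys)) (sym (∑-+ ys))

∑-mono : ∀ {A : Set} (xs : List A) {f g : A → ℤ} → (∀ x → f x ≤ᶻ g x) → ∑ xs f ≤ᶻ ∑ xs g
∑-mono []       le = ℤ.≤-refl
∑-mono (x ∷ xs) le = ℤ.+-mono-≤ (le x) (∑-mono xs le)

ind : ∀ {P : Set} → Dec P → ℤ
ind P? = if does P? then 1ℤ else 0ℤ

ind-yes : ∀ {P : Set} (P? : Dec P) → P → ind P? ≡ 1ℤ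
ind-yes P? p rewrite dec-true P? p = refl

ind-no : ∀ {P : Set} (P? : Dec P) → ¬ P → ind P? ≡ 0ℤ
ind-no P? ¬p rewrite dec-false P? ¬p = refl

ind-cong : ∀ {P Q : Set} (P? : Dec P) (Q? : Dec Q) → (P → Q) → (Q → P) → ind P? ≡ ind Q?
ind-cong P? Q? f g with P?
... | yes p = sym (ind-yes Q? (f p))
... | no ¬p = sym (ind-no Q? (¬p ∘ g))

ind-*-cong : ∀ {P : Set} (P? : Dec P) {x y : ℤ} → (P → x ≡ y) → ind P? *ᶻ x ≡ ind P? *ᶻ y
ind-*-cong (yes p) eq = cong (1ℤ *ᶻ_) (eq p)
ind-*-cong (no ¬p) eq = refl

infix 4 _≈?_
_≈?_ : ∀ {n} (σ τ : Permutation′ n) → Dec (σ ≈ τ)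
σ ≈? τ = Fin.all? λ i → (σ ⟨$⟩ʳ i) Fin.≟ (τ ⟨$⟩ʳ i)

≈-sym : ∀ {n} {σ τ : Permutation′ n} → σ ≈ τ → τ ≈ σ
≈-sym p i = sym (p i)

≈-trans : ∀ {n} {ρ σ τ : Permutation′ n} → ρ ≈ σ → σ ≈ τ → ρ ≈ τ
≈-trans p q i = trans (p i) (q i)

∑ₚ : ∀ n → (Permutation′ n → ℤ) → ℤ
∑ₚ n = ∑ (permutations n)

-- Completeness and uniqueness of the enumeration enter the argument here and nowhere else. The
-- summand serves as a delta function for changes of variables.
∑ₚ-≈ : ∀ {n} (ρ : Permutation′ n) → ∑ₚ n (λ σ → ind (ρ ≈? σ)) ≡ 1ℤ
∑ₚ-≈ {n} ρ = once (permutations n) (permutations-complete n ρ) (permutations-unique n)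
  where
  open Membership (permutationSetoid n) using (_∈_)
  open Unique (permutationSetoid n) using (Unique)

  none : ∀ xs {τ} → ρ ≈ τ → All (λ σ → ¬ (τ ≈ σ)) xs → ∑ xs (λ σ → ind (ρ ≈? σ)) ≡ 0ℤ
  none []       p []       = refl
  none (σ ∷ xs) {τ} p (q ∷ qs) =
    cong₂ _+ᶻ_ (ind-no (ρ ≈? σ) λ r → q (≈-trans {ρ = τ} {ρ} {σ} (≈-sym {σ = ρ} {τ} p) r)) (none xs {τ} p qs)

  once : ∀ xs → ρ ∈ xs → Unique xs → ∑ xs (λ σ → ind (ρ ≈? σ)) ≡ 1ℤ
  once (σ ∷ xs) (here p)  (q ∷ u) = cong₂ _+ᶻ_ (ind-yes (ρ ≈? σ) p) (none xs {σ} p q)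
  once (σ ∷ xs) (there i) (q ∷ u) = cong₂ _+ᶻ_ (ind-no (ρ ≈? σ) (apart xs q i)) (once xs i u)
    where
    apart : ∀ ys → All (λ τ → ¬ (σ ≈ τ)) ys → ρ ∈ ys → ¬ (ρ ≈ σ)
    apart (τ ∷ ys) (q ∷ qs) (here p)  r = q (≈-trans {ρ = σ} {ρ} {τ} (≈-sym {σ = ρ} {σ} r) p)
    apart (τ ∷ ys) (q ∷ qs) (there i) r = apart ys qs i r

-- A `Permutation′` carries its inverse and proofs, so a function on it may distinguish pointwise
-- equal arguments.
Respects : ∀ {n} → (Permutation′ n → ℤ) → Set
Respects G = ∀ {σ τ} → σ ≈ τ → G σ ≡ G τ

-- Both sides are evaluations of the double sum of [Φ σ ≈ τ] G τ.
∑ₚ-bij : ∀ {n} {G : Permutation′ n → ℤ} → Respects G → (Φ Ψ : Permutation′ n → Permutation′ n) →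
         (∀ {σ τ} → Φ σ ≈ τ → Ψ τ ≈ σ) → (∀ {σ τ} → Ψ τ ≈ σ → Φ σ ≈ τ) →
         ∑ₚ n (G ∘ Φ) ≡ ∑ₚ n G
∑ₚ-bij {n} {G} resp Φ Ψ to from = begin
  ∑ₚ n (G ∘ Φ)
    ≡⟨ ∑-cong P (λ σ → sym (pick (Φ σ))) ⟩
  ∑ₚ n (λ σ → ∑ₚ n λ τ → ind (Φ σ ≈? τ) *ᶻ G τ)
    ≡⟨ ∑-swap P P ⟩
  ∑ₚ n (λ τ → ∑ₚ n λ σ → ind (Φ σ ≈? τ) *ᶻ G τ)
    ≡⟨ ∑-cong P (λ τ → ∑-*ʳ (G τ) P) ⟩
  ∑ₚ n (λ τ → ∑ₚ n (λ σ → ind (Φ σ ≈? τ)) *ᶻ G τ)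
    ≡⟨ ∑-cong P (λ τ → cong (_*ᶻ G τ) (trans (∑-cong P λ σ → ind-cong (Φ σ ≈? τ) (Ψ τ ≈? σ) to from) (∑ₚ-≈ (Ψ τ)))) ⟩
  ∑ₚ n (λ τ → 1ℤ *ᶻ G τ)
    ≡⟨ ∑-cong P (λ τ → ℤ.*-identityˡ (G τ)) ⟩
  ∑ₚ n G ∎
  where
  open ≡-Reasoning
  P = permutations n

  pick : ∀ ρ → ∑ₚ n (λ τ → ind (ρ ≈? τ) *ᶻ G τ) ≡ G ρ
  pick ρ = trans (∑-cong P λ τ → ind-*-cong (ρ ≈? τ) λ p → sym (resp p)) (trans (∑-*ʳ (G ρ) P) (trans (cong (_*ᶻ G ρ) (∑ₚ-≈ ρ)) (ℤ.*-identityˡ (G ρ))))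

∑ₚ-∘ₚʳ : ∀ {n} {G : Permutation′ n → ℤ} → Respects G → (ρ : Permutation′ n) → ∑ₚ n (λ σ → G (σ ∘ₚ ρ)) ≡ ∑ₚ n G
∑ₚ-∘ₚʳ resp ρ = ∑ₚ-bij resp (_∘ₚ ρ) (_∘ₚ flip ρ)
  (λ {σ} p i → trans (cong (ρ ⟨$⟩ˡ_) (sym (p i))) (inverseˡ ρ {σ ⟨$⟩ʳ i}))
  (λ {_} {τ} p i → trans (cong (ρ ⟨$⟩ʳ_) (sym (p i))) (inverseʳ ρ {τ ⟨$⟩ʳ i}))

∑ₚ-∘ₚˡ : ∀ {n} {G : Permutation′ n → ℤ} → Respects G → (ρ : Permutation′ n) → ∑ₚ n (λ σ → G (ρ ∘ₚ σ)) ≡ ∑ₚ n G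
∑ₚ-∘ₚˡ resp ρ = ∑ₚ-bij resp (ρ ∘ₚ_) (flip ρ ∘ₚ_)
  (λ {σ} p i → trans (sym (p (ρ ⟨$⟩ˡ i))) (cong (σ ⟨$⟩ʳ_) (inverseʳ ρ)))
  (λ {_} {τ} p i → trans (sym (p (ρ ⟨$⟩ʳ i))) (cong (τ ⟨$⟩ʳ_) (inverseˡ ρ)))

-- Order isomorphism and standardization

-- Having the same standardization, without computing it. Boolean comparison makes the relation
-- decidable and turns the transport of inequalities into the use of an equation.
record Iso (n : ℕ) (f g : ℕ → ℕ) : Set where
  constructor iso
  field cmp : ∀ j k → j < n → k < n → (f j <ᵇ f k) ≡ (g j <ᵇ g k)

open Iso public

Inj : ℕ → (ℕ → ℕ) → Set
Inj n f = ∀ {j k} → j < n → k < n → f j ≡ f k → j ≡ k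

infix 4 _≡[_]_
_≡[_]_ : (ℕ → ℕ) → ℕ → (ℕ → ℕ) → Set
f ≡[ n ] g = ∀ x → x < n → f x ≡ g x

<⇒<ᵇ≡true : ∀ {a b} → a < b → (a <ᵇ b) ≡ true
<⇒<ᵇ≡true {a} {b} a<b with a <ᵇ b | ℕ.<⇒<ᵇ a<b
... | true | _ = refl

<ᵇ≡true⇒< : ∀ {a b} → (a <ᵇ b) ≡ true → a < b
<ᵇ≡true⇒< {a} {b} eq = ℕ.<ᵇ⇒< a b (subst T (sym eq) tt)

≤⇒<ᵇ≡false : ∀ {a b} → b ≤ a → (a <ᵇ b) ≡ false
≤⇒<ᵇ≡false {a} {b} b≤a with a <ᵇ b in eq
... | true  = contradiction b≤a (ℕ.<⇒≱ (<ᵇ≡true⇒< eq))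
... | false = refl

<ᵇ≡false⇒≤ : ∀ {a b} → (a <ᵇ b) ≡ false → b ≤ a
<ᵇ≡false⇒≤ eq = ℕ.≮⇒≥ λ a<b → case trans (sym (<⇒<ᵇ≡true a<b)) eq of λ ()

<ᵇ-cong : ∀ {a b c d} → (a < b → c < d) → (c < d → a < b) → (a <ᵇ b) ≡ (c <ᵇ d)
<ᵇ-cong {a} {b} f g with a <ᵇ b in eq
... | true  = sym (<⇒<ᵇ≡true (f (<ᵇ≡true⇒< eq)))
... | false = sym (≤⇒<ᵇ≡false (ℕ.≮⇒≥ λ c<d → ℕ.<⇒≱ (g c<d) (<ᵇ≡false⇒≤ eq)))

<ᵇ-transport : ∀ {a b c d} → (a <ᵇ b) ≡ (c <ᵇ d) → a < b → c < d
<ᵇ-transport eq a<b = <ᵇ≡true⇒< (trans (sym eq) (<⇒<ᵇ≡true a<b))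

Iso-refl : ∀ {n f g} → f ≡[ n ] g → Iso n f g
Iso-refl eq = iso λ j k j<n k<n → cong₂ _<ᵇ_ (eq j j<n) (eq k k<n)

Iso-sym : ∀ {n f g} → Iso n f g → Iso n g f
Iso-sym i = iso λ j k j<n k<n → sym (cmp i j k j<n k<n)

Iso-trans : ∀ {n f g h} → Iso n f g → Iso n g h → Iso n f h
Iso-trans i i′ = iso λ j k j<n k<n → trans (cmp i j k j<n k<n) (cmp i′ j k j<n k<n)

Iso-weaken : ∀ {m n f g} → m ≤ n → Iso n f g → Iso m f g
Iso-weaken m≤n i = iso λ j k j<m k<m → cmp i j k (ℕ.<-≤-trans j<m m≤n) (ℕ.<-≤-trans k<m m≤n)

Iso-shift : ∀ l {m n f g} → l + m ≤ n → Iso n f g → Iso m (f ∘ (l +_)) (g ∘ (l +_))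
Iso-shift l le i = iso λ j k j<m k<m →
  cmp i (l + j) (l + k) (ℕ.<-≤-trans (ℕ.+-monoʳ-< l j<m) le) (ℕ.<-≤-trans (ℕ.+-monoʳ-< l k<m) le)

iso? : ∀ n f g → Dec (Iso n f g)
iso? n f g = map′
  (λ p → iso λ j k j<n k<n → p j<n k<n)
  (λ p {j} j<n {k} k<n → cmp p j k j<n k<n)
  (ℕ.allUpTo? (λ j → ℕ.allUpTo? (λ k → (f j <ᵇ f k) Bool.≟ (g j <ᵇ g k)) n) n)

-- Ranks of entries

cnt : ℕ → (ℕ → ℕ) → ℕ → ℕ
cnt n f y = length (filter (ℕ._≤? y) (applyUpTo f n))

cnt≤n : ∀ n f y → cnt n f y ≤ n
cnt≤n n f y = ℕ.≤-trans (List.length-filter (ℕ._≤? y) (applyUpTo f n)) (ℕ.≤-reflexive (List.length-applyUpTo f n))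

cnt-cong : ∀ n {f g y z} → (∀ i → i < n → (f i ≤ y → g i ≤ z) × (g i ≤ z → f i ≤ y)) → cnt n f y ≡ cnt n g z
cnt-cong zero p = refl
cnt-cong (suc n) {f} {g} {y} {z} p with f 0 ℕ.≤? y | g 0 ℕ.≤? z
... | yes a | yes b rewrite dec-true (f 0 ℕ.≤? y) a | dec-true (g 0 ℕ.≤? z) b = cong suc (cnt-cong n λ i i<n → p (suc i) (s≤s i<n))
... | yes a | no ¬b = contradiction (proj₁ (p 0 z<s) a) ¬b
... | no ¬a | yes b = contradiction (proj₂ (p 0 z<s) b) ¬a
... | no ¬a | no ¬b rewrite dec-false (f 0 ℕ.≤? y) ¬a | dec-false (g 0 ℕ.≤? z) ¬b = cnt-cong n λ i i<n → p (suc i) (s≤s i<n)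

cnt-mono : ∀ n {f y z} → y ≤ z → cnt n f y ≤ cnt n f z
cnt-mono zero    le = z≤n
cnt-mono (suc n) {f} {y} {z} le with f 0 ℕ.≤? y | f 0 ℕ.≤? z
... | yes a | yes b rewrite dec-true (f 0 ℕ.≤? y) a | dec-true (f 0 ℕ.≤? z) b = s≤s (cnt-mono n le)
... | yes a | no ¬b = contradiction (ℕ.≤-trans a le) ¬b
... | no ¬a | yes b rewrite dec-false (f 0 ℕ.≤? y) ¬a | dec-true (f 0 ℕ.≤? z) b = ℕ.m≤n⇒m≤1+n (cnt-mono n le)
... | no ¬a | no ¬b rewrite dec-false (f 0 ℕ.≤? y) ¬a | dec-false (f 0 ℕ.≤? z) ¬b = cnt-mono n le

cnt-pos : ∀ n {f j y} → j < n → f j ≤ y → 0 < cnt n f y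
cnt-pos (suc n) {f} {zero}  {y} _ le rewrite dec-true (f 0 ℕ.≤? y) le = z<s
cnt-pos (suc n) {f} {suc j} {y} (s≤s j<n) le with f 0 ℕ.≤? y
... | yes a rewrite dec-true (f 0 ℕ.≤? y) a = z<s
... | no ¬a rewrite dec-false (f 0 ℕ.≤? y) ¬a = cnt-pos n j<n le

cnt-strict : ∀ n {f j y z} → j < n → y < f j → f j ≤ z → cnt n f y < cnt n f z
cnt-strict (suc n) {f} {zero} {y} {z} _ lt le
  rewrite dec-false (f 0 ℕ.≤? y) (ℕ.<⇒≱ lt) | dec-true (f 0 ℕ.≤? z) le = s≤s (cnt-mono n (ℕ.<⇒≤ (ℕ.<-≤-trans lt le)))
cnt-strict (suc n) {f} {suc j} {y} {z} (s≤s j<n) lt le with f 0 ℕ.≤? y | f 0 ℕ.≤? z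
... | yes a | yes b rewrite dec-true (f 0 ℕ.≤? y) a | dec-true (f 0 ℕ.≤? z) b = s≤s (cnt-strict n j<n lt le)
... | yes a | no ¬b = contradiction (ℕ.≤-trans a (ℕ.<⇒≤ (ℕ.<-≤-trans lt le))) ¬b
... | no ¬a | yes b rewrite dec-false (f 0 ℕ.≤? y) ¬a | dec-true (f 0 ℕ.≤? z) b = ℕ.m≤n⇒m≤1+n (cnt-strict n j<n lt le)
... | no ¬a | no ¬b rewrite dec-false (f 0 ℕ.≤? y) ¬a | dec-false (f 0 ℕ.≤? z) ¬b = cnt-strict n j<n lt le

cnt-Iso : ∀ {n f g} → Iso n f g → ∀ j → j < n → cnt n f (f j) ≡ cnt n g (g j)
cnt-Iso {n} p j j<n = cnt-cong n λ i i<n →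
  (λ le → ℕ.≮⇒≥ λ lt → ℕ.<⇒≱ (<ᵇ-transport (sym (cmp p j i j<n i<n)) lt) le) ,
  (λ le → ℕ.≮⇒≥ λ lt → ℕ.<⇒≱ (<ᵇ-transport (cmp p j i j<n i<n) lt) le)

cnt⇒< : ∀ {n f j k} → cnt n f (f j) < cnt n f (f k) → f j < f k
cnt⇒< {n} lt = ℕ.≰⇒> λ le → ℕ.<⇒≱ lt (cnt-mono n le)

Iso-cnt : ∀ {n f g} → (∀ j → j < n → cnt n f (f j) ≡ cnt n g (g j)) → Iso n f g
Iso-cnt {n} {f} {g} eq = iso λ j k j<n k<n → <ᵇ-cong
  (λ lt → cnt⇒< {n} {g} (subst₂ _<_ (eq j j<n) (eq k k<n) (cnt-strict n k<n lt ℕ.≤-refl)))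
  (λ lt → cnt⇒< {n} {f} (subst₂ _<_ (sym (eq j j<n)) (sym (eq k k<n)) (cnt-strict n k<n lt ℕ.≤-refl)))

-- The default value 0 past the end makes permutations functions on ℕ, so that the window starting
-- at i is simply `f ∘ (i +_)`.
ext : ∀ {n} → (Fin n → ℕ) → ℕ → ℕ
ext {zero}  f x       = 0
ext {suc n} f zero    = f zero
ext {suc n} f (suc x) = ext (f ∘ suc) x

ext-fromℕ< : ∀ {n} (f : Fin n → ℕ) {x} (x<n : x < n) → ext f x ≡ f (fromℕ< x<n)
ext-fromℕ< {suc n} f {zero}  x<n       = refl
ext-fromℕ< {suc n} f {suc x} (s≤s x<n) = ext-fromℕ< (f ∘ suc) x<n

ext-toℕ : ∀ {n} (f : Fin n → ℕ) i → ext f (toℕ i) ≡ f i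
ext-toℕ f zero    = refl
ext-toℕ f (suc i) = ext-toℕ (f ∘ suc) i

ext-cong : ∀ {n} {f g : Fin n → ℕ} → (∀ i → f i ≡ g i) → ∀ x → ext f x ≡ ext g x
ext-cong {zero}  eq x       = refl
ext-cong {suc n} eq zero    = eq zero
ext-cong {suc n} eq (suc x) = ext-cong (eq ∘ suc) x

val : ∀ {n} → Permutation′ n → ℕ → ℕ
val σ = ext (λ i → toℕ (σ ⟨$⟩ʳ i))

val-< : ∀ {n} (σ : Permutation′ n) {x} → x < n → val σ x < n
val-< σ x<n rewrite ext-fromℕ< (λ i → toℕ (σ ⟨$⟩ʳ i)) x<n = Fin.toℕ<n (σ ⟨$⟩ʳ fromℕ< x<n)

val-toℕ : ∀ {n} (σ : Permutation′ n) i → val σ (toℕ i) ≡ toℕ (σ ⟨$⟩ʳ i)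
val-toℕ σ = ext-toℕ (λ i → toℕ (σ ⟨$⟩ʳ i))

val-∘ₚ : ∀ {n} (ρ σ : Permutation′ n) {x} → x < n → val (ρ ∘ₚ σ) x ≡ val σ (val ρ x)
val-∘ₚ ρ σ {x} x<n = begin
  val (ρ ∘ₚ σ) x                         ≡⟨ ext-fromℕ< _ x<n ⟩
  toℕ (σ ⟨$⟩ʳ (ρ ⟨$⟩ʳ fromℕ< x<n))       ≡⟨ val-toℕ σ _ ⟨
  val σ (toℕ (ρ ⟨$⟩ʳ fromℕ< x<n))        ≡⟨ cong (val σ) (ext-fromℕ< _ x<n) ⟨
  val σ (val ρ x)                        ∎
  where open ≡-Reasoning

val-id : ∀ {n x} → x < n → val (id {n}) x ≡ x
val-id x<n = trans (ext-fromℕ< _ x<n) (Fin.toℕ-fromℕ< x<n)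

val-cong : ∀ {n} {σ τ : Permutation′ n} → σ ≈ τ → ∀ x → val σ x ≡ val τ x
val-cong p = ext-cong (λ i → cong toℕ (p i))

val-flipˡ : ∀ {n} (σ : Permutation′ n) {x} → x < n → val σ (val (flip σ) x) ≡ x
val-flipˡ σ x<n = trans (sym (val-∘ₚ (flip σ) σ x<n))
  (trans (val-cong {σ = flip σ ∘ₚ σ} {id} (λ i → inverseʳ σ) _) (val-id x<n))

val-flipʳ : ∀ {n} (σ : Permutation′ n) {x} → x < n → val (flip σ) (val σ x) ≡ x
val-flipʳ σ x<n = trans (sym (val-∘ₚ σ (flip σ) x<n))
  (trans (val-cong {σ = σ ∘ₚ flip σ} {id} (λ i → inverseˡ σ) _) (val-id x<n))

val-inj : ∀ {n} (σ : Permutation′ n) → Inj n (val σ)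
val-inj σ j<n k<n eq = trans (sym (val-flipʳ σ j<n)) (trans (cong (val (flip σ)) eq) (val-flipʳ σ k<n))

val-injective : ∀ {n} {σ τ : Permutation′ n} → val σ ≡[ n ] val τ → σ ≈ τ
val-injective {σ = σ} {τ} eq i = Fin.toℕ-injective
  (trans (sym (val-toℕ σ i)) (trans (eq (toℕ i) (Fin.toℕ<n i)) (val-toℕ τ i)))

-- Surjectivity is the pigeonhole principle: if y were missed, punching it out would inject
-- `Fin (suc n)` into `Fin n`.
injective⇒permutation : ∀ {n} (f : Fin n → Fin n) → (∀ {i j} → f i ≡ f j → i ≡ j) →
                        Σ[ ρ ∈ Permutation′ n ] (∀ i → ρ ⟨$⟩ʳ i ≡ f i)
injective⇒permutation {n} f inj =
  permutation f (proj₁ ∘ surj f inj) (proj₂ ∘ surj f inj) (λ i → inj (proj₂ (surj f inj (f i)))) , λ i → refl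
  where
  surj : ∀ {n} (f : Fin n → Fin n) → (∀ {i j} → f i ≡ f j → i ≡ j) → ∀ y → ∃ λ x → f x ≡ y
  surj {suc n} f inj y with Fin.any? (λ x → f x Fin.≟ y)
  ... | yes p = p
  ... | no ¬p = contradiction
    (Fin.injective⇒≤ {f = λ x → punchOut (miss x)} λ {i} {j} eq → inj (Fin.punchOut-injective (miss i) (miss j) eq))
    ℕ.1+n≰n
    where
    miss : ∀ x → y ≢ f x
    miss x eq = ¬p (x , sym eq)

bounded-injective⇒permutation : ∀ n h → (∀ {x} → x < n → h x < n) → Inj n h →
                                Σ[ ρ ∈ Permutation′ n ] val ρ ≡[ n ] h
bounded-injective⇒permutation n h bd inj =
  let ρ , eq = injective⇒permutation (λ i → fromℕ< (bd (Fin.toℕ<n i)))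
                 (λ {i} {j} p → Fin.toℕ-injective (inj (Fin.toℕ<n i) (Fin.toℕ<n j) (Fin.fromℕ<-injective _ _ _ _ p)))
  in ρ , λ x x<n → trans (ext-fromℕ< _ x<n) (trans (cong toℕ (eq (fromℕ< x<n)))
           (trans (Fin.toℕ-fromℕ< _) (cong h (Fin.toℕ-fromℕ< x<n))))

-- The ranks of the entries of `h` form the permutation; `cnt` ranks from 1, hence the `pred`.
standardize : ∀ n h → Inj n h → Σ[ ρ ∈ Permutation′ n ] Iso n (val ρ) h
standardize n h inj =
  let ρ , eq = bounded-injective⇒permutation n rank rank-< rank-inj
  in ρ , iso λ j k j<n k<n → trans (cong₂ _<ᵇ_ (eq j j<n) (eq k k<n)) (<ᵇ-cong (back j<n k<n) (forth j<n k<n))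
  where
  rank : ℕ → ℕ
  rank x = pred (cnt n h (h x))

  suc-rank : ∀ {x} → x < n → suc (rank x) ≡ cnt n h (h x)
  suc-rank {x} x<n = ℕ.suc-pred _ ⦃ >-nonZero (cnt-pos n {h} x<n ℕ.≤-refl) ⦄

  rank-< : ∀ {x} → x < n → rank x < n
  rank-< {x} x<n = subst (_≤ n) (sym (suc-rank x<n)) (cnt≤n n h (h x))

  forth : ∀ {j k} → j < n → k < n → h j < h k → rank j < rank k
  forth j<n k<n lt = s<s⁻¹ (subst₂ _<_ (sym (suc-rank j<n)) (sym (suc-rank k<n)) (cnt-strict n k<n lt ℕ.≤-refl))

  back : ∀ {j k} → j < n → k < n → rank j < rank k → h j < h k
  back j<n k<n lt = cnt⇒< {n} {h} (subst₂ _<_ (suc-rank j<n) (suc-rank k<n) (s<s lt))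

  rank-inj : Inj n rank
  rank-inj {j} {k} j<n k<n eq with ℕ.<-cmp (h j) (h k)
  ... | tri< lt _ _ = contradiction eq (ℕ.<⇒≢ (forth j<n k<n lt))
  ... | tri≈ _ e _  = inj j<n k<n e
  ... | tri> _ _ gt = contradiction (sym eq) (ℕ.<⇒≢ (forth k<n j<n gt))

-- Every value below n is attained, so the count is positive at 0 and grows by at least one with
-- each value; as it never exceeds n, there is no slack.
cnt-val : ∀ {n} (σ : Permutation′ n) {y} → y < n → cnt n (val σ) y ≡ suc y
cnt-val {n} σ {y} y<n = ℕ.≤-antisym (ℕ.+-cancelʳ-≤ (n ∸ suc y) _ _ (subst (φ y + (n ∸ suc y) ≤_) (sym (ℕ.m+[n∸m]≡n y<n))
  (upper (n ∸ suc y) y (ℕ.m+[n∸m]≡n y<n)))) (lower y y<n)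
  where
  φ : ℕ → ℕ
  φ = cnt n (val σ)

  lower : ∀ y → y < n → y < φ y
  lower zero    0<n = cnt-pos n (val-< (flip σ) 0<n) (ℕ.≤-reflexive (val-flipˡ σ 0<n))
  lower (suc y) y<n = ℕ.<-≤-trans (s≤s (lower y (ℕ.<-trans ℕ.≤-refl y<n))) (step y y<n)
    where
    step : ∀ y → suc y < n → φ y < φ (suc y)
    step y y<n = cnt-strict n (val-< (flip σ) y<n) (ℕ.≤-reflexive (sym (val-flipˡ σ y<n))) (ℕ.≤-reflexive (val-flipˡ σ y<n))

  upper : ∀ d y → suc y + d ≡ n → φ y + d ≤ n
  upper zero    y eq = subst (_≤ n) (sym (ℕ.+-identityʳ (φ y))) (cnt≤n n (val σ) y)
  upper (suc d) y eq = subst (_≤ n) (sym (ℕ.+-suc (φ y) d)) (ℕ.≤-trans (ℕ.+-monoˡ-≤ d step) (upper d (suc y) eq′))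
    where
    eq′ : suc (suc y) + d ≡ n
    eq′ = trans (cong suc (sym (ℕ.+-suc y d))) eq
    y<n′ : suc y < n
    y<n′ = subst (suc y <_) eq′ (s≤s (s≤s (ℕ.m≤m+n y d)))
    step : φ y < φ (suc y)
    step = cnt-strict n (val-< (flip σ) y<n′) (ℕ.≤-reflexive (sym (val-flipˡ σ y<n′))) (ℕ.≤-reflexive (val-flipˡ σ y<n′))

Iso⇒≈ : ∀ {n} {σ τ : Permutation′ n} → Iso n (val σ) (val τ) → σ ≈ τ
Iso⇒≈ {n} {σ} {τ} p = val-injective {σ = σ} {τ} λ x x<n → ℕ.suc-injective
  (trans (sym (cnt-val σ (val-< σ x<n))) (trans (cnt-Iso p x x<n) (cnt-val τ (val-< τ x<n))))

-- Independence of disjoint blocks of positions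

Inv : ℕ → ((ℕ → ℕ) → ℤ) → Set
Inv n g = ∀ {f f′} → Iso n f f′ → g f ≡ g f′

S : ∀ n → ((ℕ → ℕ) → ℤ) → ℤ
S n g = ∑ₚ n (λ σ → g (val σ))

S-cong : ∀ n {g g′} → (∀ f → g f ≡ g′ f) → S n g ≡ S n g′
S-cong n eq = ∑-cong (permutations n) λ σ → eq (val σ)

Inv⇒Respects : ∀ {n g} → Inv n g → Respects {n} (λ σ → g (val σ))
Inv⇒Respects inv {σ} {τ} p = inv (Iso-refl λ x _ → val-cong {σ = σ} {τ} p x)

S-∘ʳ : ∀ {n g} → Inv n g → (ρ : Permutation′ n) → S n (λ f → g (f ∘ val ρ)) ≡ S n g
S-∘ʳ {n} {g} inv ρ = trans
  (∑-cong (permutations n) λ σ → inv (Iso-refl λ x x<n → sym (val-∘ₚ ρ σ x<n)))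
  (∑ₚ-∘ₚˡ (λ {σ} {τ} → Inv⇒Respects {n} {g} inv {σ} {τ}) ρ)

-- Only the standardization of `f` matters, and composing with that fixed permutation merely
-- permutes the summands.
S-∘ˡ : ∀ {n g} → Inv n g → ∀ f → Inj n f → S n (λ α → g (f ∘ α)) ≡ S n g
S-∘ˡ {n} {g} inv f inj = trans
  (∑-cong (permutations n) λ α → inv (iso λ j k j<n k<n → trans
    (sym (cmp std (val α j) (val α k) (val-< α j<n) (val-< α k<n)))
    (cong₂ _<ᵇ_ (sym (val-∘ₚ α ρ j<n)) (sym (val-∘ₚ α ρ k<n)))))
  (∑ₚ-∘ₚʳ (λ {σ} {τ} → Inv⇒Respects {n} {g} inv {σ} {τ}) ρ)
  where
  ρ   = proj₁ (standardize n f inj)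
  std = proj₂ (standardize n f inj)

infixr 6 _⊕_
_⊕_ : ∀ {l k} → Permutation′ l → Permutation′ k → Permutation′ (l + k)
α ⊕ β = ↔-sym Fin.+↔⊎ ↔-∘ ((α ⊎-↔ β) ↔-∘ Fin.+↔⊎)

val-⊕ˡ : ∀ {l k} (α : Permutation′ l) (β : Permutation′ k) → val (α ⊕ β) ≡[ l ] val α
val-⊕ˡ {l} {k} α β x x<l = begin
  val (α ⊕ β) x                                 ≡⟨ cong (val (α ⊕ β)) (trans (Fin.toℕ-↑ˡ (fromℕ< x<l) k) (Fin.toℕ-fromℕ< x<l)) ⟨
  val (α ⊕ β) (toℕ (fromℕ< x<l ↑ˡ k))           ≡⟨ val-toℕ (α ⊕ β) (fromℕ< x<l ↑ˡ k) ⟩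
  toℕ ((α ⊕ β) ⟨$⟩ʳ (fromℕ< x<l ↑ˡ k))          ≡⟨ cong (λ z → toℕ (join l k (Sum.map (α ⟨$⟩ʳ_) (β ⟨$⟩ʳ_) z))) (Fin.splitAt-↑ˡ l (fromℕ< x<l) k) ⟩
  toℕ ((α ⟨$⟩ʳ fromℕ< x<l) ↑ˡ k)                ≡⟨ Fin.toℕ-↑ˡ _ k ⟩
  toℕ (α ⟨$⟩ʳ fromℕ< x<l)                       ≡⟨ ext-fromℕ< _ x<l ⟨
  val α x                                       ∎
  where open ≡-Reasoning

val-⊕ʳ : ∀ {l k} (α : Permutation′ l) (β : Permutation′ k) → val (α ⊕ β) ∘ (l +_) ≡[ k ] (l +_) ∘ val β
val-⊕ʳ {l} {k} α β x x<k = begin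
  val (α ⊕ β) (l + x)                           ≡⟨ cong (val (α ⊕ β)) (trans (Fin.toℕ-↑ʳ l (fromℕ< x<k)) (cong (l +_) (Fin.toℕ-fromℕ< x<k))) ⟨
  val (α ⊕ β) (toℕ (l ↑ʳ fromℕ< x<k))           ≡⟨ val-toℕ (α ⊕ β) (l ↑ʳ fromℕ< x<k) ⟩
  toℕ ((α ⊕ β) ⟨$⟩ʳ (l ↑ʳ fromℕ< x<k))          ≡⟨ cong (λ z → toℕ (join l k (Sum.map (α ⟨$⟩ʳ_) (β ⟨$⟩ʳ_) z))) (Fin.splitAt-↑ʳ l k (fromℕ< x<k)) ⟩
  toℕ (l ↑ʳ (β ⟨$⟩ʳ fromℕ< x<k))                ≡⟨ Fin.toℕ-↑ʳ l _ ⟩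
  l + toℕ (β ⟨$⟩ʳ fromℕ< x<k)                   ≡⟨ cong (l +_) (ext-fromℕ< _ x<k) ⟨
  l + val β x                                   ∎
  where open ≡-Reasoning

#S : ℕ → ℤ
#S n = S n (λ _ → 1ℤ)

S-const : ∀ n c → S n (λ _ → c) ≡ #S n *ᶻ c
S-const n c = trans (S-cong n {λ _ → c} λ _ → sym (ℤ.*-identityˡ c)) (∑-*ʳ c (permutations n))

ι : ℕ → (ℕ → ℕ) → ℤ
ι n f = ind (iso? n f (λ x → x))

S-ι : ∀ n → S n (ι n) ≡ 1ℤ
S-ι n = trans (∑-cong (permutations n) λ σ → ind-cong (iso? n (val σ) (λ x → x)) (id ≈? σ)
  (λ p → Iso⇒≈ {σ = id} {σ} (Iso-trans (Iso-refl λ x x<n → val-id x<n) (Iso-sym p)))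
  (λ p → Iso-refl λ x x<n → trans (sym (val-cong {σ = id} {σ} p x)) (val-id x<n)))
  (∑ₚ-≈ {n} id)

ι-Inv : ∀ n → Inv n (ι n)
ι-Inv n {f} {f′} i = ind-cong (iso? n f (λ x → x)) (iso? n f′ (λ x → x)) (Iso-trans (Iso-sym i)) (Iso-trans i)

ind≤1 : ∀ {P : Set} (P? : Dec P) → ind P? ≤ᶻ 1ℤ
ind≤1 (yes _) = ℤ.≤-refl
ind≤1 (no _)  = +≤+ z≤n

0≤ind : ∀ {P : Set} (P? : Dec P) → 0ℤ ≤ᶻ ind P?
0≤ind (yes _) = +≤+ z≤n
0≤ind (no _)  = ℤ.≤-refl

-- `#S n` is n factorial, and the identity alone already contributes 1.
#S≢0 : ∀ n → #S n ≢ 0ℤ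
#S≢0 n eq = case ℤ.≤-trans (ℤ.≤-reflexive (sym (S-ι n)))
  (ℤ.≤-trans (∑-mono (permutations n) λ σ → ind≤1 (iso? n (val σ) (λ x → x))) (ℤ.≤-reflexive eq)) of λ { (+≤+ ()) }

-- Averaging over rearrangements of the first l and of the last k entries does not change
-- the sum over 𝔖_{l+k}, and replaces the two factors by their averages.
S-indep : ∀ l k {g h} → Inv l g → Inv k h →
          #S l *ᶻ #S k *ᶻ S (l + k) (λ f → g f *ᶻ h (f ∘ (l +_))) ≡ #S (l + k) *ᶻ (S l g *ᶻ S k h)
S-indep l k {g} {h} ginv hinv = begin
  #S l *ᶻ #S k *ᶻ S (l + k) gh
    ≡⟨ ℤ.*-assoc (#S l) (#S k) _ ⟩
  #S l *ᶻ (#S k *ᶻ S (l + k) gh)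
    ≡⟨ trans (∑-cong A λ α → S-const k (S (l + k) gh)) (S-const l _) ⟨
  (∑ A λ α → ∑ B λ β → S (l + k) gh)
    ≡⟨ ∑-cong A (λ α → ∑-cong B λ β → sym (trans (∑-cong C λ σ → cong₂ _*ᶻ_
         (ginv (Iso-refl λ x x<l → cong (val σ) (sym (val-⊕ˡ α β x x<l))))
         (hinv (Iso-refl λ x x<k → cong (val σ) (sym (val-⊕ʳ α β x x<k)))))
         (S-∘ʳ {l + k} {gh} gh-inv (α ⊕ β)))) ⟩
  (∑ A λ α → ∑ B λ β → ∑ C λ σ → g (val σ ∘ val α) *ᶻ h ((val σ ∘ (l +_)) ∘ val β))
    ≡⟨ ∑-cong A (λ α → ∑-swap B C) ⟩
  (∑ A λ α → ∑ C λ σ → ∑ B λ β → g (val σ ∘ val α) *ᶻ h ((val σ ∘ (l +_)) ∘ val β))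
    ≡⟨ ∑-cong A (λ α → ∑-cong C λ σ → trans (∑-*ˡ (g (val σ ∘ val α)) B)
         (cong (g (val σ ∘ val α) *ᶻ_) (S-∘ˡ {k} {h} hinv _ λ j<k k<k eq → ℕ.+-cancelˡ-≡ l _ _
           (val-inj σ (ℕ.+-monoʳ-< l j<k) (ℕ.+-monoʳ-< l k<k) eq)))) ⟩
  (∑ A λ α → ∑ C λ σ → g (val σ ∘ val α) *ᶻ S k h)
    ≡⟨ ∑-swap A C ⟩
  (∑ C λ σ → ∑ A λ α → g (val σ ∘ val α) *ᶻ S k h)
    ≡⟨ ∑-cong C (λ σ → trans (∑-*ʳ (S k h) A) (cong (_*ᶻ S k h) (S-∘ˡ {l} {g} ginv _ λ j<l k<l eq →
         val-inj σ (ℕ.<-≤-trans j<l (ℕ.m≤m+n l k)) (ℕ.<-≤-trans k<l (ℕ.m≤m+n l k)) eq))) ⟩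
  (∑ C λ σ → S l g *ᶻ S k h)
    ≡⟨ S-const (l + k) _ ⟩
  #S (l + k) *ᶻ (S l g *ᶻ S k h) ∎
  where
  open ≡-Reasoning
  A = permutations l
  B = permutations k
  C = permutations (l + k)

  gh : (ℕ → ℕ) → ℤ
  gh f = g f *ᶻ h (f ∘ (l +_))

  gh-inv : Inv (l + k) gh
  gh-inv i = cong₂ _*ᶻ_ (ginv (Iso-weaken (ℕ.m≤m+n l k) i)) (hinv (Iso-shift l ℕ.≤-refl i))

-- The binomial coefficient (l+k choose l): the identity is the only permutation counted by ι.
κ : ℕ → ℕ → ℤ
κ l k = S (l + k) (λ f → ι l f *ᶻ ι k (f ∘ (l +_)))

-- `S-indep` holds for g and h, and also for `ι l` and `ι k`, whose sums are 1. Comparing the two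
-- instances and cancelling `#S l *ᶻ #S k` yields the factor without any division.
S-* : ∀ l k {g h} → Inv l g → Inv k h →
      S (l + k) (λ f → g f *ᶻ h (f ∘ (l +_))) ≡ κ l k *ᶻ (S l g *ᶻ S k h)
S-* l k {g} {h} ginv hinv = ℤ.*-cancelˡ-≡ c _ _ ⦃ ≢0 ⦄ (begin
  c *ᶻ S (l + k) (λ f → g f *ᶻ h (f ∘ (l +_)))       ≡⟨ S-indep l k {g} {h} ginv hinv ⟩
  #S (l + k) *ᶻ X                                    ≡⟨ cong (_*ᶻ X) (trans (S-indep l k {ι l} {ι k} (ι-Inv l) (ι-Inv k)) unit) ⟨
  c *ᶻ κ l k *ᶻ X                                    ≡⟨ ℤ.*-assoc c (κ l k) X ⟩
  c *ᶻ (κ l k *ᶻ X)                                  ∎)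
  where
  open ≡-Reasoning
  c = #S l *ᶻ #S k
  X = S l g *ᶻ S k h

  ≢0 : ℤ.NonZero c
  ≢0 = ℤ.≢-nonZero λ eq → [ #S≢0 l , #S≢0 k ]′ (ℤ.i*j≡0⇒i≡0∨j≡0 (#S l) eq)

  unit : #S (l + k) *ᶻ (S l (ι l) *ᶻ S k (ι k)) ≡ #S (l + k)
  unit rewrite S-ι l | S-ι k = ℤ.*-identityʳ _

κ-0 : ∀ n → κ n 0 ≡ 1ℤ
κ-0 n = trans (subst (λ N → S N (λ f → ι n f *ᶻ 1ℤ) ≡ S n (λ f → ι n f *ᶻ 1ℤ)) (sym (ℕ.+-identityʳ n)) refl)
  (trans (S-cong n λ f → ℤ.*-identityʳ (ι n f)) (S-ι n))

-- Markings and clusters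

-- The sum over l + k = n. With the factor `κ l k` it is the product of exponential generating
-- functions.
conv : ℕ → (ℕ → ℕ → ℤ) → ℤ
conv zero    φ = φ 0 0
conv (suc n) φ = φ 0 (suc n) +ᶻ conv n (λ l k → φ (suc l) k)

conv-cong : ∀ n {φ ψ} → (∀ l k → l + k ≡ n → φ l k ≡ ψ l k) → conv n φ ≡ conv n ψ
conv-cong zero    eq = eq 0 0 refl
conv-cong (suc n) eq = cong₂ _+ᶻ_ (eq 0 (suc n) refl) (conv-cong n λ l k p → eq (suc l) k (cong suc p))

conv-zero : ∀ n {φ} → (∀ l k → l + k ≡ n → φ l k ≡ 0ℤ) → conv n φ ≡ 0ℤ
conv-zero zero    eq = eq 0 0 refl
conv-zero (suc n) eq = cong₂ _+ᶻ_ (eq 0 (suc n) refl) (conv-zero n λ l k p → eq (suc l) k (cong suc p))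

conv-+ : ∀ n {φ ψ} → conv n (λ l k → φ l k +ᶻ ψ l k) ≡ conv n φ +ᶻ conv n ψ
conv-+ zero            = refl
conv-+ (suc n) {φ} {ψ} = trans (cong ((φ 0 (suc n) +ᶻ ψ 0 (suc n)) +ᶻ_) (conv-+ n)) (+-interchange (φ 0 (suc n)) (ψ 0 (suc n)) _ _)

conv-last : ∀ n φ → conv (suc n) φ ≡ conv n (λ l k → φ l (suc k)) +ᶻ φ (suc n) 0
conv-last zero    φ = refl
conv-last (suc n) φ = trans (cong (φ 0 (2 + n) +ᶻ_) (conv-last n (λ l → φ (suc l))))
  (sym (ℤ.+-assoc (φ 0 (2 + n)) _ _))

∑-++ : ∀ {A : Set} (xs ys : List A) {f : A → ℤ} → ∑ (xs ++ ys) f ≡ ∑ xs f +ᶻ ∑ ys f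
∑-++ []       ys     = sym (ℤ.+-identityˡ _)
∑-++ (x ∷ xs) ys {f} = trans (cong (f x +ᶻ_) (∑-++ xs ys)) (sym (ℤ.+-assoc (f x) _ _))

∑-map : ∀ {A B : Set} (h : A → B) xs {f : B → ℤ} → ∑ (map h xs) f ≡ ∑ xs (f ∘ h)
∑-map h []           = refl
∑-map h (x ∷ xs) {f} = cong (f (h x) +ᶻ_) (∑-map h xs)

∑-cong-All : ∀ {A : Set} {P : A → Set} {xs} → All P xs → {f g : A → ℤ} → (∀ {x} → P x → f x ≡ g x) → ∑ xs f ≡ ∑ xs g
∑-cong-All []       eq = refl
∑-cong-All (p ∷ ps) eq = cong₂ _+ᶻ_ (eq p) (∑-cong-All ps eq)

Marking : Set
Marking = List Bool

weight : ℤ → Marking → ℤ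
weight t []      = 1ℤ
weight t (b ∷ s) = (if b then t else 1ℤ) *ᶻ weight t s

weight-++ : ∀ t s u → weight t (s ++ u) ≡ weight t s *ᶻ weight t u
weight-++ t []      u = sym (ℤ.*-identityˡ _)
weight-++ t (b ∷ s) u = trans (cong ((if b then t else 1ℤ) *ᶻ_) (weight-++ t s u))
  (sym (ℤ.*-assoc (if b then t else 1ℤ) _ _))

-- A mark at a position stands for a marked occurrence of a pattern of length suc M that starts
-- there; markings M n are those in which every marked window lies within the n positions.
module _ (M : ℕ) where

  markings : ℕ → List Marking
  markings zero    = [] ∷ []
  markings (suc n) = map (false ∷_) (markings n) ++ (if M ≤ᵇ n then map (true ∷_) (markings n) else [])

  -- The markings of n positions whose windows, together with a window that covers the first
  -- r positions, form a single cluster that ends at the last position; consecutive windows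
  -- of a cluster share at least one position.
  clusters : ℕ → ℕ → List Marking
  clusters zero    zero    = [] ∷ []
  clusters zero    (suc n) = []
  clusters (suc r) zero    = []
  clusters (suc r) (suc n) = map (false ∷_) (clusters r n) ++ map (true ∷_) (clusters (r ⊔ M) n)

  Fits : Marking → Set
  Fits []          = ⊤
  Fits (false ∷ s) = Fits s
  Fits (true ∷ s)  = M ≤ length s × Fits s

  data Cluster : ℕ → ℕ → Marking → Set where
    done  : Cluster 0 0 []
    plain : ∀ {r n s} → Cluster r n s → Cluster (suc r) (suc n) (false ∷ s)
    mark  : ∀ {r n s} → Cluster (r ⊔ M) n s → Cluster (suc r) (suc n) (true ∷ s)

  Cluster-length : ∀ {r n s} → Cluster r n s → length s ≡ n
  Cluster-length done      = refl
  Cluster-length (plain c) = cong suc (Cluster-length c)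
  Cluster-length (mark c)  = cong suc (Cluster-length c)

  Cluster-≤ : ∀ {r n s} → Cluster r n s → r ≤ n
  Cluster-≤ done      = z≤n
  Cluster-≤ (plain c) = s≤s (Cluster-≤ c)
  Cluster-≤ (mark {r} c)  = s≤s (ℕ.≤-trans (ℕ.m≤m⊔n r M) (Cluster-≤ c))

  Cluster-Fits : ∀ {r n s} → Cluster r n s → Fits s
  Cluster-Fits done      = tt
  Cluster-Fits (plain c) = Cluster-Fits c
  Cluster-Fits (mark {r} c) =
    subst (M ≤_) (sym (Cluster-length c)) (ℕ.≤-trans (ℕ.m≤n⊔m r M) (Cluster-≤ c)) , Cluster-Fits c

  clusters-Cluster : ∀ r n → All (Cluster r n) (clusters r n)
  clusters-Cluster zero    zero    = done ∷ []
  clusters-Cluster zero    (suc n) = []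
  clusters-Cluster (suc r) zero    = []
  clusters-Cluster (suc r) (suc n) = All.++⁺
    (All.map⁺ (All.map plain (clusters-Cluster r n)))
    (All.map⁺ (All.map mark (clusters-Cluster (r ⊔ M) n)))

  markings-Fits : ∀ n → All (λ s → length s ≡ n × Fits s) (markings n)
  markings-Fits zero    = (refl , tt) ∷ []
  markings-Fits (suc n) = All.++⁺ (All.map⁺ (All.map (λ (p , q) → cong suc p , q) (markings-Fits n))) marked
    where
    marked : All (λ s → length s ≡ suc n × Fits s) (if M ≤ᵇ n then map (true ∷_) (markings n) else [])
    marked with M ≤ᵇ n in eq
    ... | false = []
    ... | true  = All.map⁺ (All.map (λ (p , q) → cong suc p ,
                    subst (M ≤_) (sym p) (ℕ.≤ᵇ⇒≤ M n (subst T (sym eq) tt)) , q) (markings-Fits n))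

  clusters-empty : ∀ {r n} → n < r → clusters r n ≡ []
  clusters-empty {suc r} {zero}  lt       = refl
  clusters-empty {suc r} {suc n} (s≤s lt) =
    cong₂ (λ xs ys → map (false ∷_) xs ++ map (true ∷_) ys)
      (clusters-empty lt) (clusters-empty (ℕ.<-≤-trans lt (ℕ.m≤m⊔n r M)))

  -- The marking is cut where its first cluster ends. A plain position uses up one of the r covered
  -- positions, a mark extends the cover to at least M further positions, and once r = 0 the
  -- remainder is unrestricted.
  markings-split : ∀ r n → r ≤ n → (g : Marking → ℤ) →
    ∑ (markings n) g ≡ conv n (λ l k → ∑ (clusters r l) λ s → ∑ (markings k) λ u → g (s ++ u))
  markings-split zero zero _ g = sym (ℤ.+-identityʳ _)
  markings-split zero (suc n) _ g = sym (trans
    (cong₂ _+ᶻ_ (ℤ.+-identityʳ (∑ (markings (suc n)) g)) (conv-zero n λ l k _ → refl)) (ℤ.+-identityʳ _))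
  markings-split (suc r) (suc n) (s≤s r≤n) g = begin
    ∑ (map (false ∷_) (markings n) ++ (if M ≤ᵇ n then map (true ∷_) (markings n) else [])) g
      ≡⟨ ∑-++ (map (false ∷_) (markings n)) _ ⟩
    ∑ (map (false ∷_) (markings n)) g +ᶻ ∑ (if M ≤ᵇ n then map (true ∷_) (markings n) else []) g
      ≡⟨ cong₂ _+ᶻ_ (trans (∑-map (false ∷_) (markings n)) (markings-split r n r≤n (g ∘ (false ∷_)))) marked ⟩
    conv n (λ l k → φ false r l k) +ᶻ conv n (λ l k → φ true (r ⊔ M) l k)
      ≡⟨ conv-+ n ⟨
    conv n (λ l k → φ false r l k +ᶻ φ true (r ⊔ M) l k)
      ≡⟨ conv-cong n (λ l k _ → sym (trans (∑-++ (map (false ∷_) (clusters r l)) _)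
           (cong₂ _+ᶻ_ (∑-map (false ∷_) (clusters r l)) (∑-map (true ∷_) (clusters (r ⊔ M) l))))) ⟩
    conv n (λ l k → ∑ (clusters (suc r) (suc l)) λ s → ∑ (markings k) λ u → g (s ++ u))
      ≡⟨ ℤ.+-identityˡ _ ⟨
    conv (suc n) (λ l k → ∑ (clusters (suc r) l) λ s → ∑ (markings k) λ u → g (s ++ u)) ∎
    where
    open ≡-Reasoning
    φ : Bool → ℕ → ℕ → ℕ → ℤ
    φ b r l k = ∑ (clusters r l) λ s → ∑ (markings k) λ u → g (b ∷ s ++ u)

    marked : ∑ (if M ≤ᵇ n then map (true ∷_) (markings n) else []) g ≡ conv n (λ l k → φ true (r ⊔ M) l k)
    marked with M ≤ᵇ n in eq
    ... | true  = trans (∑-map (true ∷_) (markings n))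
      (markings-split (r ⊔ M) n (ℕ.⊔-lub r≤n (ℕ.≤ᵇ⇒≤ M n (subst T (sym eq) tt))) (g ∘ (true ∷_)))
    -- A window starting here would run past the end, and no cluster containing it is short enough.
    ... | false = sym (conv-zero n λ l k l+k≡n → cong (λ xs → ∑ xs λ s → ∑ (markings k) λ u → g (true ∷ s ++ u))
      (clusters-empty (ℕ.<-≤-trans (ℕ.≤-<-trans (ℕ.m+n≤o⇒m≤o l (ℕ.≤-reflexive l+k≡n)) n<M) (ℕ.m≤n⊔m r M))))
      where
      n<M : n < M
      n<M = ℕ.≰⇒> λ le → subst T eq (ℕ.≤⇒≤ᵇ le)

-- Marked occurrences and the cluster recursion

module _ (M : ℕ) (p : ℕ → ℕ) where

  e : (ℕ → ℕ) → ℤ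
  e f = ind (iso? (suc M) f p)

  occ : Marking → (ℕ → ℕ) → ℤ
  occ []      f = 1ℤ
  occ (b ∷ s) f = (if b then e f else 1ℤ) *ᶻ occ s (f ∘ suc)

  e-Inv : Inv (suc M) e
  e-Inv {f} {f′} i = ind-cong (iso? (suc M) f p) (iso? (suc M) f′ p) (Iso-trans (Iso-sym i)) (Iso-trans i)

  occ-Inv : ∀ s → Fits M s → Inv (length s) (occ s)
  occ-Inv []          fits        i = refl
  occ-Inv (false ∷ s) fits        i = cong (1ℤ *ᶻ_) (occ-Inv s fits (Iso-shift 1 ℕ.≤-refl i))
  occ-Inv (true ∷ s)  (le , fits) i =
    cong₂ _*ᶻ_ (e-Inv (Iso-weaken (s≤s le) i)) (occ-Inv s fits (Iso-shift 1 ℕ.≤-refl i))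

  occ-++ : ∀ s u f → occ (s ++ u) f ≡ occ s f *ᶻ occ u (f ∘ (length s +_))
  occ-++ []      u f = sym (ℤ.*-identityˡ _)
  occ-++ (b ∷ s) u f = trans (cong ((if b then e f else 1ℤ) *ᶻ_) (occ-++ s u (f ∘ suc)))
    (sym (ℤ.*-assoc (if b then e f else 1ℤ) _ _))

  N : ℕ → Marking → ℤ
  N n s = S n (occ s)

  N-++ : ∀ {l k s u} → length s ≡ l → length u ≡ k → Fits M s → Fits M u →
         N (l + k) (s ++ u) ≡ κ l k *ᶻ (N l s *ᶻ N k u)
  N-++ {_} {_} {s} {u} refl refl fs fu = trans (S-cong (length s + length u) (occ-++ s u))
    (S-* (length s) (length u) {occ s} {occ u} (occ-Inv s fs) (occ-Inv u fu))

  -- F and C are, up to the factor n!, the coefficients of the generating functions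
  -- of all marked permutations and of the clusters.
  F C : ℤ → ℕ → ℤ
  F t n = ∑ (markings M n) λ s → weight t s *ᶻ N n s
  C t n = ∑ (clusters M 1 n) λ s → weight t s *ᶻ N n s

  -- In generating functions this is F = 1 + C F: the first cluster is followed by an arbitrary
  -- marked permutation. A position outside all windows counts as a cluster of length 1.
  F-rec : ∀ t n → F t (suc n) ≡ conv (suc n) (λ l k → κ l k *ᶻ (C t l *ᶻ F t k))
  F-rec t n = trans (markings-split M 1 (suc n) (s≤s z≤n) (λ s → weight t s *ᶻ N (suc n) s))
    (conv-cong (suc n) λ { l k l+k≡n → begin
      (∑ (clusters M 1 l) λ s → ∑ (markings M k) λ u → weight t (s ++ u) *ᶻ N (suc n) (s ++ u))
        ≡⟨ ∑-cong-All (clusters-Cluster M 1 l) (λ {s} c → ∑-cong-All (markings-Fits M k) λ {u} (eq , fits) →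
             trans (cong₂ _*ᶻ_ (weight-++ t s u) (trans (cong (λ N′ → N N′ (s ++ u)) (sym l+k≡n))
               (N-++ {l} {k} {s} {u} (Cluster-length M c) eq (Cluster-Fits M c) fits)))
             (rearrange (weight t s) (weight t u) (κ l k) (N l s) (N k u))) ⟩
      (∑ (clusters M 1 l) λ s → ∑ (markings M k) λ u → κ l k *ᶻ (weight t s *ᶻ N l s) *ᶻ (weight t u *ᶻ N k u))
        ≡⟨ ∑-cong (clusters M 1 l) (λ s → ∑-*ˡ (κ l k *ᶻ (weight t s *ᶻ N l s)) (markings M k)) ⟩
      (∑ (clusters M 1 l) λ s → κ l k *ᶻ (weight t s *ᶻ N l s) *ᶻ F t k)
        ≡⟨ ∑-*ʳ (F t k) (clusters M 1 l) ⟩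
      (∑ (clusters M 1 l) λ s → κ l k *ᶻ (weight t s *ᶻ N l s)) *ᶻ F t k
        ≡⟨ cong (_*ᶻ F t k) (∑-*ˡ (κ l k) (clusters M 1 l)) ⟩
      κ l k *ᶻ C t l *ᶻ F t k
        ≡⟨ ℤ.*-assoc (κ l k) _ _ ⟩
      κ l k *ᶻ (C t l *ᶻ F t k) ∎ })
    where
    open ≡-Reasoning
    rearrange : ∀ a b c d x → a *ᶻ b *ᶻ (c *ᶻ (d *ᶻ x)) ≡ c *ᶻ (a *ᶻ d) *ᶻ (b *ᶻ x)
    rearrange = solve-∀

  G : ℤ → ℕ → (ℕ → ℕ) → ℤ
  G t zero    f = 1ℤ
  G t (suc n) f = (if M ≤ᵇ n then 1ℤ +ᶻ t *ᶻ e f else 1ℤ) *ᶻ G t n (f ∘ suc)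

  -- Expanding the product `G` means choosing 1 or `t *ᶻ e f` at each position where a window fits,
  -- and such a choice is a marking.
  ∑-occ : ∀ t n f → ∑ (markings M n) (λ s → weight t s *ᶻ occ s f) ≡ G t n f
  ∑-occ t zero    f = refl
  ∑-occ t (suc n) f with M ≤ᵇ n
  ... | false = trans (cong (λ xs → ∑ xs λ s → weight t s *ᶻ occ s f) (List.++-identityʳ (map (false ∷_) (markings M n))))
    (trans (∑-map (false ∷_) (markings M n)) (trans (∑-cong (markings M n) λ s →
      cong₂ _*ᶻ_ (ℤ.*-identityˡ (weight t s)) (ℤ.*-identityˡ (occ s (f ∘ suc)))) (trans (∑-occ t n (f ∘ suc)) (sym (ℤ.*-identityˡ _)))))
  ... | true = begin
    ∑ (map (false ∷_) (markings M n) ++ map (true ∷_) (markings M n)) (λ s → weight t s *ᶻ occ s f)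
      ≡⟨ ∑-++ (map (false ∷_) (markings M n)) _ ⟩
    _ ≡⟨ cong₂ _+ᶻ_ (trans (∑-map (false ∷_) (markings M n)) (∑-cong (markings M n) λ s →
           cong₂ _*ᶻ_ (ℤ.*-identityˡ (weight t s)) (ℤ.*-identityˡ (occ s (f ∘ suc)))))
         (trans (∑-map (true ∷_) (markings M n)) (trans (∑-cong (markings M n) λ s →
           interchange t (weight t s) (e f) (occ s (f ∘ suc))) (∑-*ˡ (t *ᶻ e f) (markings M n)))) ⟩
    ∑ (markings M n) (λ s → weight t s *ᶻ occ s (f ∘ suc)) +ᶻ t *ᶻ e f *ᶻ ∑ (markings M n) (λ s → weight t s *ᶻ occ s (f ∘ suc))
      ≡⟨ factor (t *ᶻ e f) _ ⟩
    (1ℤ +ᶻ t *ᶻ e f) *ᶻ ∑ (markings M n) (λ s → weight t s *ᶻ occ s (f ∘ suc))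
      ≡⟨ cong ((1ℤ +ᶻ t *ᶻ e f) *ᶻ_) (∑-occ t n (f ∘ suc)) ⟩
    (1ℤ +ᶻ t *ᶻ e f) *ᶻ G t n (f ∘ suc) ∎
    where
    open ≡-Reasoning
    interchange : ∀ a b c d → a *ᶻ b *ᶻ (c *ᶻ d) ≡ a *ᶻ c *ᶻ (b *ᶻ d)
    interchange = solve-∀
    factor : ∀ a b → b +ᶻ a *ᶻ b ≡ (1ℤ +ᶻ a) *ᶻ b
    factor = solve-∀

  F≡S-G : ∀ t n → F t n ≡ S n (G t n)
  F≡S-G t n = begin
    (∑ (markings M n) λ s → weight t s *ᶻ N n s)
      ≡⟨ ∑-cong (markings M n) (λ s → ∑-*ˡ (weight t s) (permutations n)) ⟨
    (∑ (markings M n) λ s → ∑ (permutations n) λ σ → weight t s *ᶻ occ s (val σ))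
      ≡⟨ ∑-swap (markings M n) (permutations n) ⟩
    (∑ (permutations n) λ σ → ∑ (markings M n) λ s → weight t s *ᶻ occ s (val σ))
      ≡⟨ ∑-cong (permutations n) (λ σ → ∑-occ t n (val σ)) ⟩
    S n (G t n) ∎
    where open ≡-Reasoning

module _ (M : ℕ) (p q : ℕ → ℕ) (t : ℤ) where

  private
    term : (ℕ → ℕ) → (ℕ → ℕ) → ℕ → ℕ → ℤ
    term p p′ l k = κ l k *ᶻ (C M p t l *ᶻ F M p′ t k)

  -- Since `C M p t 0` is 0, the recursion for F at k + 1 involves F only at indices up to k.
  C⇒F : (∀ n → C M p t n ≡ C M q t n) → ∀ n → F M p t n ≡ F M q t n
  C⇒F eq n = upto n n ℕ.≤-refl
    where
    upto : ∀ n k → k ≤ n → F M p t k ≡ F M q t k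
    upto n       zero    _         = refl
    upto (suc n) (suc k) (s≤s k≤n) = begin
      F M p t (suc k)                                                   ≡⟨ F-rec M p t k ⟩
      conv (suc k) (term p p)                                           ≡⟨ cong₂ _+ᶻ_ (ℤ.*-zeroʳ (κ 0 (suc k)))
        (conv-cong k λ l j l+j≡k → cong (κ (suc l) j *ᶻ_) (cong₂ _*ᶻ_ (eq (suc l))
          (upto n j (ℕ.≤-trans (ℕ.m+n≤o⇒n≤o l (ℕ.≤-reflexive l+j≡k)) k≤n)))) ⟩
      0ℤ +ᶻ conv k (λ l → term q q (suc l))                             ≡⟨ cong (_+ᶻ conv k (λ l → term q q (suc l))) (ℤ.*-zeroʳ (κ 0 (suc k))) ⟨
      conv (suc k) (term q q)                                           ≡⟨ F-rec M q t k ⟨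
      F M q t (suc k)                                                   ∎
      where open ≡-Reasoning

  -- In the recursion at k + 1 the value of C at k + 1 occurs only in the term with F at 0, where
  -- its coefficient is 1 by `κ-0`; all other terms involve C at smaller indices.
  F⇒C : (∀ n → F M p t n ≡ F M q t n) → ∀ n → C M p t n ≡ C M q t n
  F⇒C eq n = upto n n ℕ.≤-refl
    where
    last-term : ∀ p n → term p p n 0 ≡ C M p t n
    last-term p n = trans (cong₂ _*ᶻ_ (κ-0 n) (ℤ.*-identityʳ (C M p t n))) (ℤ.*-identityˡ (C M p t n))

    upto : ∀ n k → k ≤ n → C M p t k ≡ C M q t k
    upto n       zero    _         = refl
    upto (suc n) (suc k) (s≤s k≤n) = ∙-cancelˡ (conv k λ l j → term p p l (suc j)) _ _ (begin
      conv k (λ l j → term p p l (suc j)) +ᶻ C M p t (suc k)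
        ≡⟨ cong (conv k (λ l j → term p p l (suc j)) +ᶻ_) (last-term p (suc k)) ⟨
      conv k (λ l j → term p p l (suc j)) +ᶻ term p p (suc k) 0
        ≡⟨ trans (F-rec M p t k) (conv-last k (term p p)) ⟨
      F M p t (suc k)
        ≡⟨ eq (suc k) ⟩
      F M q t (suc k)
        ≡⟨ trans (F-rec M q t k) (conv-last k (term q q)) ⟩
      conv k (λ l j → term q q l (suc j)) +ᶻ term q q (suc k) 0
        ≡⟨ cong₂ _+ᶻ_ (conv-cong k λ l j l+j≡k → cong (κ l (suc j) *ᶻ_) (cong₂ _*ᶻ_
             (sym (upto n l (ℕ.≤-trans (ℕ.m+n≤o⇒m≤o l (ℕ.≤-reflexive l+j≡k)) k≤n))) (sym (eq (suc j)))))
             (last-term q (suc k)) ⟩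
      conv k (λ l j → term p p l (suc j)) +ᶻ C M q t (suc k) ∎)
      where open ≡-Reasoning

-- Occurrences in one-line notation

tabulate≡applyUpTo : ∀ {n} (f : Fin n → ℕ) → tabulate (λ i → ℕ.suc (f i)) ≡ applyUpTo (ℕ.suc ∘ ext f) n
tabulate≡applyUpTo {zero}  f = refl
tabulate≡applyUpTo {suc n} f = cong (suc (f zero) ∷_) (tabulate≡applyUpTo (f ∘ suc))

oneLine≡applyUpTo : ∀ {n} (σ : Permutation′ n) → oneLine σ ≡ applyUpTo (suc ∘ val σ) n
oneLine≡applyUpTo σ = tabulate≡applyUpTo (λ i → toℕ (σ ⟨$⟩ʳ i))

applyUpTo-cong : ∀ n {f g : ℕ → ℕ} → f ≡[ n ] g → applyUpTo f n ≡ applyUpTo g n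
applyUpTo-cong zero    eq = refl
applyUpTo-cong (suc n) eq = cong₂ _∷_ (eq 0 z<s) (applyUpTo-cong n λ x x<n → eq (suc x) (s≤s x<n))

applyUpTo-injective : ∀ n {f g : ℕ → ℕ} → applyUpTo f n ≡ applyUpTo g n → f ≡[ n ] g
applyUpTo-injective (suc n) eq zero    _         = List.∷-injectiveˡ eq
applyUpTo-injective (suc n) eq (suc x) (s≤s x<n) = applyUpTo-injective n (List.∷-injectiveʳ eq) x x<n

take-applyUpTo : ∀ {m n} (h : ℕ → ℕ) → m ≤ n → take m (applyUpTo h n) ≡ applyUpTo h m
take-applyUpTo h z≤n     = refl
take-applyUpTo h (s≤s p) = cong (h 0 ∷_) (take-applyUpTo (h ∘ suc) p)

factor-applyUpTo : ∀ i {m n} (h : ℕ → ℕ) → i + m ≤ n → drop i (take (i + m) (applyUpTo h n)) ≡ applyUpTo (h ∘ (i +_)) m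
factor-applyUpTo zero    h p       = take-applyUpTo h p
factor-applyUpTo (suc i) h (s≤s p) = factor-applyUpTo i (h ∘ suc) p

cnt-suc : ∀ m f y → cnt m (suc ∘ f) (suc y) ≡ cnt m f y
cnt-suc m f y = cnt-cong m λ i i<m → s≤s⁻¹ , s≤s

st-applyUpTo : ∀ m f → st (applyUpTo (suc ∘ f) m) ≡ applyUpTo (λ j → cnt m f (f j)) m
st-applyUpTo m f = trans (List.map-applyUpTo (suc ∘ f) _ m) (applyUpTo-cong m λ j _ → cnt-suc m f (f j))

st≡⇒Iso : ∀ m {f g} → st (applyUpTo (suc ∘ f) m) ≡ st (applyUpTo (suc ∘ g) m) → Iso m f g
st≡⇒Iso m {f} {g} eq = Iso-cnt (applyUpTo-injective m (trans (sym (st-applyUpTo m f)) (trans eq (st-applyUpTo m g))))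

Iso⇒st≡ : ∀ m {f g} → Iso m f g → st (applyUpTo (suc ∘ f) m) ≡ st (applyUpTo (suc ∘ g) m)
Iso⇒st≡ m {f} {g} i = trans (st-applyUpTo m f) (trans (applyUpTo-cong m (cnt-Iso i)) (sym (st-applyUpTo m g)))

st-oneLine : ∀ {m} (π : Permutation′ m) → st (applyUpTo (suc ∘ val π) m) ≡ oneLine π
st-oneLine {m} π = trans (st-applyUpTo m (val π))
  (trans (applyUpTo-cong m λ j j<m → cnt-val π (val-< π j<m)) (sym (oneLine≡applyUpTo π)))

module _ {M n : ℕ} (π : Permutation′ (suc M)) (σ : Permutation′ n) where

  private
    Occurs : ℕ → Set
    Occurs i = st (oneLine σ [ i ⋯ i + suc M ∸ 1 ]) ≡ oneLine π

    window : ∀ i → i + suc M ≤ n → oneLine σ [ suc i ⋯ suc i + suc M ∸ 1 ] ≡ applyUpTo (suc ∘ val σ ∘ (i +_)) (suc M)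
    window i le = trans (cong (λ w → drop i (take (i + suc M) w)) (oneLine≡applyUpTo σ)) (factor-applyUpTo i (suc ∘ val σ) le)

  Occurs⇒Iso : ∀ i → i + suc M ≤ n → Occurs (suc i) → Iso (suc M) (val σ ∘ (i +_)) (val π)
  Occurs⇒Iso i le o = st≡⇒Iso (suc M) (trans (cong st (sym (window i le))) (trans o (sym (st-oneLine π))))

  Iso⇒Occurs : ∀ i → i + suc M ≤ n → Iso (suc M) (val σ ∘ (i +_)) (val π) → Occurs (suc i)
  Iso⇒Occurs i le o = trans (cong st (window i le)) (trans (Iso⇒st≡ (suc M) o) (st-oneLine π))

module _ (M : ℕ) (p : ℕ → ℕ) (t : ℤ) where

  private
    -- `G` indexed by the number of windows instead of the number of positions, to match the list of
    -- starting positions in `Em`.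
    K : ℕ → (ℕ → ℕ) → ℤ
    K zero    f = 1ℤ
    K (suc q) f = (1ℤ +ᶻ t *ᶻ e M p f) *ᶻ K q (f ∘ suc)

  G≡K : ∀ n f → G M p t n f ≡ K (n ∸ M) f
  G≡K zero    f rewrite ℕ.0∸n≡0 M = refl
  G≡K (suc n) f with M ≤ᵇ n in eq
  ... | true  rewrite ℕ.+-∸-assoc 1 (ℕ.≤ᵇ⇒≤ M n (subst T (sym eq) tt)) = cong ((1ℤ +ᶻ t *ᶻ e M p f) *ᶻ_) (G≡K n (f ∘ suc))
  ... | false = trans (cong (1ℤ *ᶻ_) (trans (G≡K n (f ∘ suc)) (cong (λ k → K k (f ∘ suc)) (ℕ.m≤n⇒m∸n≡0 (ℕ.<⇒≤ n<M)))))
    (cong (λ k → K k f) (sym (ℕ.m≤n⇒m∸n≡0 n<M)))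
    where
    n<M : n < M
    n<M = ℕ.≰⇒> λ le → subst T eq (ℕ.≤⇒≤ᵇ le)

  filter≡K : ∀ {P : ℕ → Set} (P? : Decidable P) q h f →
             (∀ i → i < q → (P (h i) → Iso (suc M) (f ∘ (i +_)) p) × (Iso (suc M) (f ∘ (i +_)) p → P (h i))) →
             (1ℤ +ᶻ t) ^ᶻ length (filter P? (applyUpTo h q)) ≡ K q f
  filter≡K P? zero    h f eqv = refl
  filter≡K P? (suc q) h f eqv with P? (h 0)
  ... | yes Ph =
    cong₂ _*ᶻ_ (sym (trans (cong (λ z → 1ℤ +ᶻ t *ᶻ z) (ind-yes (iso? (suc M) f p) (proj₁ (eqv 0 z<s) Ph))) (cong (1ℤ +ᶻ_) (ℤ.*-identityʳ t))))
      (filter≡K P? q (h ∘ suc) (f ∘ suc) λ i i<q → eqv (suc i) (s≤s i<q))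
  ... | no ¬Ph = trans
    (filter≡K P? q (h ∘ suc) (f ∘ suc) λ i i<q → eqv (suc i) (s≤s i<q))
    (trans (sym (ℤ.*-identityˡ _)) (cong (_*ᶻ K q (f ∘ suc))
      (sym (trans (cong (λ z → 1ℤ +ᶻ t *ᶻ z) (ind-no (iso? (suc M) f p) (¬Ph ∘ proj₂ (eqv 0 z<s)))) (cong (1ℤ +ᶻ_) (ℤ.*-zeroʳ t))))))

G≡^em : ∀ {M n} (π : Permutation′ (suc M)) (σ : Permutation′ n) t → G M (val π) t n (val σ) ≡ (1ℤ +ᶻ t) ^ᶻ em π σ
G≡^em {M} {n} π σ t = trans (G≡K M (val π) t n (val σ)) (sym (filter≡K M (val π) t
  (λ i → st (oneLine σ [ i ⋯ i + suc M ∸ 1 ]) ≟ʷ oneLine π) (n ∸ M) suc (val σ)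
  λ i i<n∸M → Occurs⇒Iso π σ i (fit i i<n∸M) , Iso⇒Occurs π σ i (fit i i<n∸M)))
  where
  fit : ∀ i → i < n ∸ M → i + suc M ≤ n
  fit i i<n∸M = subst (_≤ n) (sym (ℕ.+-suc i M)) (ℕ.m≤o∸n⇒m+n≤o (suc i) M≤n i<n∸M)
    where
    M≤n : M ≤ n
    M≤n = ℕ.<⇒≤ (ℕ.m∸n≢0⇒n<m {n} {M} λ eq → case subst (suc i ≤_) eq i<n∸M of λ ())

F≡∑^em : ∀ {M} (π : Permutation′ (suc M)) t n → F M (val π) t n ≡ ∑ₚ n (λ σ → (1ℤ +ᶻ t) ^ᶻ em π σ)
F≡∑^em {M} π t n = trans (F≡S-G M (val π) t n) (∑-cong (permutations n) λ σ → G≡^em π σ t)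

-- From the numbers `a π n k` to the sums `F`

length-filter≡∑ : ∀ {A : Set} {P : A → Set} (P? : Decidable P) xs → pos (length (filter P? xs)) ≡ ∑ xs (ind ∘ P?)
length-filter≡∑ P? []       = refl
length-filter≡∑ P? (x ∷ xs) with does (P? x)
... | true  = cong (1ℤ +ᶻ_) (length-filter≡∑ P? xs)
... | false = trans (length-filter≡∑ P? xs) (sym (ℤ.+-identityˡ _))

∑-by-value : ∀ {A : Set} (xs : List A) (φ : A → ℕ) (h : ℕ → ℤ) {b} → (∀ x → φ x < b) →
             ∑ xs (h ∘ φ) ≡ ∑ (downFrom b) (λ k → h k *ᶻ pos (length (filter (λ x → φ x ℕ.≟ k) xs)))
∑-by-value xs φ h {b} bd = begin
  ∑ xs (h ∘ φ)
    ≡⟨ ∑-cong xs (λ x → pick b (bd x)) ⟨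
  (∑ xs λ x → ∑ (downFrom b) λ k → h k *ᶻ ind (φ x ℕ.≟ k))
    ≡⟨ ∑-swap xs (downFrom b) ⟩
  (∑ (downFrom b) λ k → ∑ xs λ x → h k *ᶻ ind (φ x ℕ.≟ k))
    ≡⟨ ∑-cong (downFrom b) (λ k → trans (∑-*ˡ (h k) xs) (cong (h k *ᶻ_) (sym (length-filter≡∑ (λ x → φ x ℕ.≟ k) xs)))) ⟩
  ∑ (downFrom b) (λ k → h k *ᶻ pos (length (filter (λ x → φ x ℕ.≟ k) xs))) ∎
  where
  open ≡-Reasoning
  none : ∀ b {v} → b ≤ v → ∑ (downFrom b) (λ k → h k *ᶻ ind (v ℕ.≟ k)) ≡ 0ℤ
  none zero    le = refl
  none (suc b) {v} le = cong₂ _+ᶻ_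
    (trans (cong (h b *ᶻ_) (ind-no (v ℕ.≟ b) λ { refl → ℕ.1+n≰n le })) (ℤ.*-zeroʳ (h b))) (none b (ℕ.<⇒≤ le))

  pick : ∀ b {v} → v < b → ∑ (downFrom b) (λ k → h k *ᶻ ind (v ℕ.≟ k)) ≡ h v
  pick (suc b) {v} (s≤s v≤b) with ℕ.m≤n⇒m<n∨m≡n v≤b
  ... | inj₁ v<b  = trans (cong₂ _+ᶻ_ (trans (cong (h b *ᶻ_) (ind-no (v ℕ.≟ b) (ℕ.<⇒≢ v<b))) (ℤ.*-zeroʳ (h b))) (pick b v<b))
    (ℤ.+-identityˡ (h v))
  ... | inj₂ refl = trans (cong₂ _+ᶻ_ (trans (cong (h v *ᶻ_) (ind-yes (v ℕ.≟ v) refl)) (ℤ.*-identityʳ (h v))) (none v ℕ.≤-refl))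
    (ℤ.+-identityʳ (h v))

module _ {M : ℕ} (π τ : Permutation′ (suc M)) where

  strong⇒F : StronglyCWilfEquivalent π τ → ∀ t n → F M (val π) t n ≡ F M (val τ) t n
  strong⇒F eq t n = begin
    F M (val π) t n                                              ≡⟨ F≡∑^em π t n ⟩
    ∑ₚ n (λ σ → (1ℤ +ᶻ t) ^ᶻ em π σ)                             ≡⟨ ∑-by-value (permutations n) (em π) ((1ℤ +ᶻ t) ^ᶻ_) (em-< π) ⟩
    ∑ (downFrom (suc n)) (λ k → (1ℤ +ᶻ t) ^ᶻ k *ᶻ pos (a π n k)) ≡⟨ ∑-cong (downFrom (suc n)) (λ k → cong (λ c → (1ℤ +ᶻ t) ^ᶻ k *ᶻ pos c) (eq n k)) ⟩
    ∑ (downFrom (suc n)) (λ k → (1ℤ +ᶻ t) ^ᶻ k *ᶻ pos (a τ n k)) ≡⟨ ∑-by-value (permutations n) (em τ) ((1ℤ +ᶻ t) ^ᶻ_) (em-< τ) ⟨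
    ∑ₚ n (λ σ → (1ℤ +ᶻ t) ^ᶻ em τ σ)                             ≡⟨ F≡∑^em τ t n ⟨
    F M (val τ) t n                                              ∎
    where
    open ≡-Reasoning
    em-< : ∀ (π : Permutation′ (suc M)) (σ : Permutation′ n) → em π σ < suc n
    em-< π σ = s≤s (ℕ.≤-trans (List.length-filter _ [1⋯ n ∸ M ])
      (ℕ.≤-trans (ℕ.≤-reflexive (List.length-applyUpTo suc (n ∸ M))) (ℕ.m∸n≤m n M)))

  F⇒cWilf : (∀ n → F M (val π) -1ℤ n ≡ F M (val τ) -1ℤ n) → CWilfEquivalent π τ
  F⇒cWilf eq n = ℤ.+-injective (trans (sym (F≡a π)) (trans (eq n) (F≡a τ)))
    where
    -- With t = -1 the weight is a power of 0, and 0 to the power 0 is 1, so exactly the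
    -- permutations without an occurrence are counted.
    0^ : ∀ k → 0ℤ ^ᶻ k ≡ ind (k ℕ.≟ 0)
    0^ zero    = refl
    0^ (suc k) = ℤ.*-zeroˡ (0ℤ ^ᶻ k)

    F≡a : ∀ π → F M (val π) -1ℤ n ≡ pos (a π n 0)
    F≡a π = trans (F≡∑^em π -1ℤ n) (trans (∑-cong (permutations n) λ σ → 0^ (em π σ))
      (sym (length-filter≡∑ (λ σ → em π σ ℕ.≟ 0) (permutations n))))

-- Chains of windows

private
  -- Takes the place of comparing constant terms of polynomials, although Y and Y′ may vary with t:
  -- the difference X - X′ is a multiple of t, and t = |X - X′| + 1 exceeds its absolute value, so
  -- it vanishes.
  coefficient-0 : ∀ {X X′ : ℤ} → (∀ t → t ≢ 0ℤ → ∃₂ λ Y Y′ → X +ᶻ t *ᶻ Y ≡ X′ +ᶻ t *ᶻ Y′) → X ≡ X′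
  coefficient-0 {X} {X′} eq = ℤ.i-j≡0⇒i≡j X X′ (trans D≡tZ (trans (cong (t *ᶻ_) Z≡0) (ℤ.*-zeroʳ t)))
    where
    D = X -ᶻ X′
    t = pos (suc (abs D))
    Y = proj₁ (eq t λ ())
    Y′ = proj₁ (proj₂ (eq t λ ()))
    Z = Y′ -ᶻ Y

    move : ∀ t X X′ Y Y′ → X -ᶻ X′ ≡ (X +ᶻ t *ᶻ Y) -ᶻ X′ -ᶻ t *ᶻ Y
    move = solve-∀
    move′ : ∀ t X′ Y Y′ → (X′ +ᶻ t *ᶻ Y′) -ᶻ X′ -ᶻ t *ᶻ Y ≡ t *ᶻ (Y′ -ᶻ Y)
    move′ = solve-∀

    D≡tZ : D ≡ t *ᶻ Z
    D≡tZ = trans (move t X X′ Y Y′) (trans (cong (λ z → z -ᶻ X′ -ᶻ t *ᶻ Y) (proj₂ (proj₂ (eq t λ ())))) (move′ t X′ Y Y′))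

    Z≡0 : Z ≡ 0ℤ
    Z≡0 = ℤ.∣i∣≡0⇒i≡0 (small (abs Z) (trans (cong abs D≡tZ) (ℤ.abs-* t Z)))
      where
      small : ∀ z → abs D ≡ suc (abs D) * z → z ≡ 0
      small zero    _ = refl
      small (suc z) p = contradiction (ℕ.≤-trans (ℕ.m≤m*n (suc (abs D)) (suc z)) (ℕ.≤-reflexive (sym p))) ℕ.1+n≰n

module _ (M′ : ℕ) where

  private
    M : ℕ
    M = suc M′

  -- k consecutive windows, each sharing one position with the next, preceded by r positions.
  chain : ℕ → ℕ → Marking
  chain (suc r) k       = false ∷ chain r k
  chain zero    zero    = false ∷ []
  chain zero    (suc k) = true ∷ chain M′ k

  chain-Cluster : ∀ r k → Cluster M (suc r) (suc r + k * M) (chain r k)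
  chain-Cluster (suc r) k       = plain (chain-Cluster r k)
  chain-Cluster zero    zero    = plain done
  chain-Cluster zero    (suc k) = mark (chain-Cluster M′ k)

  occ-chain : ∀ p r k f → occ M p (chain r k) f ≡ occ M p (chain 0 k) (f ∘ (r +_))
  occ-chain p zero    k f = refl
  occ-chain p (suc r) k f = trans (ℤ.*-identityˡ _) (occ-chain p r k (f ∘ suc))

  module _ (t : ℤ) where

    clusters-step : ∀ r n (g : Marking → ℤ) →
      ∑ (clusters M (suc r) (suc n)) (λ s → weight t s *ᶻ g s) ≡
      ∑ (clusters M r n) (λ s → weight t s *ᶻ g (false ∷ s)) +ᶻ t *ᶻ ∑ (clusters M (r ⊔ M) n) (λ s → weight t s *ᶻ g (true ∷ s))
    clusters-step r n g = trans (∑-++ (map (false ∷_) (clusters M r n)) _) (cong₂ _+ᶻ_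
      (trans (∑-map (false ∷_) (clusters M r n)) (∑-cong (clusters M r n) λ s → cong (_*ᶻ g (false ∷ s)) (ℤ.*-identityˡ (weight t s))))
      (trans (∑-map (true ∷_) (clusters M (r ⊔ M) n)) (trans (∑-cong (clusters M (r ⊔ M) n) λ s →
        ℤ.*-assoc t (weight t s) (g (true ∷ s))) (∑-*ˡ t (clusters M (r ⊔ M) n)))))

    -- At least k windows are needed to reach the last position.
    clusters-low : ∀ k r n (g : Marking → ℤ) → r + k * M < n + M →
                   ∃ λ Y → ∑ (clusters M r n) (λ s → weight t s *ᶻ g s) ≡ t ^ᶻ k *ᶻ Y
    clusters-low zero    r       n       g lt = _ , sym (ℤ.*-identityˡ _)
    clusters-low (suc k) zero    zero    g lt = contradiction (ℕ.≤-trans (ℕ.m≤m+n M (k * M)) ℕ.≤-refl) (ℕ.<⇒≱ lt)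
    clusters-low (suc k) zero    (suc n) g lt = 0ℤ , sym (ℤ.*-zeroʳ (t ^ᶻ suc k))
    clusters-low (suc k) (suc r) zero    g lt = 0ℤ , sym (ℤ.*-zeroʳ (t ^ᶻ suc k))
    clusters-low (suc k) (suc r) (suc n) g lt =
      let Y , eq   = clusters-low (suc k) r n (g ∘ (false ∷_)) (s<s⁻¹ lt)
          Y′ , eq′ = clusters-low k (r ⊔ M) n (g ∘ (true ∷_)) (ℕ.≤-<-trans (ℕ.≤-trans
                       (ℕ.+-monoˡ-≤ (k * M) (ℕ.m⊔n≤m+n r M)) (ℕ.≤-reflexive (ℕ.+-assoc r M (k * M)))) (s<s⁻¹ lt))
      in Y +ᶻ Y′ , trans (clusters-step r n g) (trans (cong₂ (λ x y → x +ᶻ t *ᶻ y) eq eq′) (factor t (t ^ᶻ k) Y Y′))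
      where
      factor : ∀ t u Y Y′ → t *ᶻ u *ᶻ Y +ᶻ t *ᶻ (u *ᶻ Y′) ≡ t *ᶻ u *ᶻ (Y +ᶻ Y′)
      factor = solve-∀

    -- Exactly k windows suffice only when they form a chain.
    clusters-exact : ∀ k r (g : Marking → ℤ) →
                     ∃ λ Y → ∑ (clusters M (suc r) (suc r + k * M)) (λ s → weight t s *ᶻ g s) ≡ t ^ᶻ k *ᶻ (g (chain r k) +ᶻ t *ᶻ Y)
    clusters-exact zero zero g = 0ℤ , trans (clusters-step 0 0 g) (base (g (false ∷ [])) t)
      where
      base : ∀ x t → 1ℤ *ᶻ x +ᶻ 0ℤ +ᶻ t *ᶻ 0ℤ ≡ 1ℤ *ᶻ (x +ᶻ t *ᶻ 0ℤ)
      base = solve-∀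
    clusters-exact (suc k) zero g =
      let Y , eq = clusters-exact k M′ (g ∘ (true ∷_))
      in Y , trans (clusters-step 0 (M + k * M) g) (trans (cong (λ x → 0ℤ +ᶻ t *ᶻ x) eq)
        (factor t (t ^ᶻ k) (g (chain 0 (suc k)) +ᶻ t *ᶻ Y)))
      where
      factor : ∀ t u x → 0ℤ +ᶻ t *ᶻ (u *ᶻ x) ≡ t *ᶻ u *ᶻ x
      factor = solve-∀
    -- A mark set while more than one position is covered loses reach: k further windows are still
    -- required after it, so its term carries an extra factor t.
    clusters-exact k (suc r) g =
      let Y , eq   = clusters-exact k r (g ∘ (false ∷_))
          Y′ , eq′ = clusters-low k (suc r ⊔ M) (suc r + k * M) (g ∘ (true ∷_)) (subst (suc r ⊔ M + k * M <_)
                       (trans (ℕ.+-assoc (suc r) M (k * M)) (trans (cong (suc r +_) (ℕ.+-comm M (k * M))) (sym (ℕ.+-assoc (suc r) (k * M) M))))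
                       (ℕ.+-monoˡ-< (k * M) (ℕ.⊔-lub (s≤s (ℕ.m<m+n r z<s)) (s≤s (ℕ.m≤n+m M r)))))
      in Y +ᶻ Y′ , trans (clusters-step (suc r) (suc r + k * M) g) (trans (cong₂ (λ x y → x +ᶻ t *ᶻ y) eq eq′)
        (factor t (t ^ᶻ k) (g (chain (suc r) k)) Y Y′))
      where
      factor : ∀ t u x Y Y′ → u *ᶻ (x +ᶻ t *ᶻ Y) +ᶻ t *ᶻ (u *ᶻ Y′) ≡ u *ᶻ (x +ᶻ t *ᶻ (Y +ᶻ Y′))
      factor = solve-∀

  abstract

    -- Abstract, so that the sum over all permutations is unfolded only by appeal to `N-chain-def`.
    N-chain : (ℕ → ℕ) → ℕ → ℤ
    N-chain p k = N M p (suc (k * M)) (chain 0 k)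

    N-chain-def : ∀ p k → N-chain p k ≡ N M p (suc (k * M)) (chain 0 k)
    N-chain-def p k = refl

  -- At length kM + 1, C is t^k times the chain number plus a multiple of t^(k+1); cancelling t^k
  -- for t ≠ 0 leaves the situation of `coefficient-0`.
  C⇒N-chain : ∀ {p q} → (∀ t n → C M p t n ≡ C M q t n) → ∀ k → N-chain p k ≡ N-chain q k
  C⇒N-chain {p} {q} eq k = trans (N-chain-def p k) (trans (coefficient-0 λ t t≢0 →
    let Y , y  = clusters-exact t k 0 (N M p (suc (k * M)))
        Z , z  = clusters-exact t k 0 (N M q (suc (k * M)))
    in Y , Z , ℤ.*-cancelˡ-≡ (t ^ᶻ k) _ _ ⦃ ℤ.≢-nonZero λ z → t≢0 (ℤ.i^n≡0⇒i≡0 t k z) ⦄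
         (trans (sym y) (trans (eq t (suc (k * M))) z)))
    (sym (N-chain-def q k)))

  -- Some mark lies among the first r positions. Right after a marked position, with r = M′, this
  -- means two windows offset by less than M.
  data Near : ℕ → Marking → Set where
    here  : ∀ {r s} → Near (suc r) (true ∷ s)
    there : ∀ {r b s} → Near r s → Near (suc r) (b ∷ s)

  -- Two of the marked windows share at least two positions.
  data Overlap : Marking → Set where
    clash : ∀ {s} → Near M′ s → Overlap (true ∷ s)
    later : ∀ {b s} → Overlap s → Overlap (b ∷ s)

  -- With r + 1 positions still covered, a mark on the last of them continues the chain, and a mark
  -- on an earlier one overlaps the covering window too much.
  Cluster-cases : ∀ {r n s} → Cluster M (suc r) n s → (∃ λ k → s ≡ chain r k × n ≡ suc r + k * M) ⊎ Near r s ⊎ Overlap s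
  Cluster-cases {zero}  (plain done) = inj₁ (0 , refl , refl)
  Cluster-cases {suc r} (plain c) with Cluster-cases c
  ... | inj₁ (k , eq , eq′)  = inj₁ (k , cong (false ∷_) eq , cong suc eq′)
  ... | inj₂ (inj₁ near)     = inj₂ (inj₁ (there near))
  ... | inj₂ (inj₂ o)        = inj₂ (inj₂ (later o))
  Cluster-cases {zero}  (mark c) with Cluster-cases c
  ... | inj₁ (k , eq , eq′)  = inj₁ (suc k , cong (true ∷_) eq , cong suc eq′)
  ... | inj₂ (inj₁ near)     = inj₂ (inj₂ (clash near))
  ... | inj₂ (inj₂ o)        = inj₂ (inj₂ (later o))
  Cluster-cases {suc r} (mark c) = inj₂ (inj₁ here)

  -- The excluded overlaps have length at least 2 and shift at least 1. The overlap of length 1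
  -- occurs in every pattern and accounts for the element m - 1 of the overlap set.
  SelfOverlapFree : (ℕ → ℕ) → Set
  SelfOverlapFree p = ∀ d c → suc d + suc (suc c) ≡ suc M → ¬ Iso (suc (suc c)) (p ∘ (suc d +_)) p

  module _ {p : ℕ → ℕ} (free : SelfOverlapFree p) where

    Near-occ : ∀ {r s} → Near r s → ∀ f → occ M p s f ≡ 0ℤ ⊎ ∃ λ i → i < r × Iso (suc M) (f ∘ (i +_)) p
    Near-occ {s = true ∷ s} here f with iso? (suc M) f p
    ... | yes i = inj₂ (0 , z<s , i)
    ... | no ¬i = inj₁ (trans (cong (_*ᶻ occ M p s (f ∘ suc)) (ind-no (iso? (suc M) f p) ¬i)) (ℤ.*-zeroˡ (occ M p s (f ∘ suc))))
    Near-occ {s = b ∷ s} (there near) f with Near-occ near (f ∘ suc)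
    ... | inj₁ z             = inj₁ (trans (cong ((if b then e M p f else 1ℤ) *ᶻ_) z) (ℤ.*-zeroʳ (if b then e M p f else 1ℤ)))
    ... | inj₂ (i , lt , ii) = inj₂ (suc i , s≤s lt , ii)

    -- If both windows were occurrences, their common positions would make a suffix of p order
    -- isomorphic to a prefix of p.
    Overlap-occ : ∀ {s} → Overlap s → ∀ f → occ M p s f ≡ 0ℤ
    Overlap-occ {b ∷ s} (later o) f =
      trans (cong ((if b then e M p f else 1ℤ) *ᶻ_) (Overlap-occ o (f ∘ suc))) (ℤ.*-zeroʳ (if b then e M p f else 1ℤ))
    Overlap-occ {true ∷ s} (clash near) f with iso? (suc M) f p | Near-occ near (f ∘ suc)
    ... | no ¬i | _      = trans (cong (_*ᶻ occ M p s (f ∘ suc)) (ind-no (iso? (suc M) f p) ¬i)) (ℤ.*-zeroˡ (occ M p s (f ∘ suc)))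
    ... | yes i | inj₁ z = trans (cong (e M p f *ᶻ_) z) (ℤ.*-zeroʳ (e M p f))
    ... | yes i | inj₂ (d , d<M′ , i′) = contradiction
      (Iso-trans (Iso-sym (Iso-shift (suc d) (ℕ.≤-reflexive sum) i)) (Iso-weaken c≤M i′)) (free d c sum)
      where
      c = M′ ∸ suc d
      sum : suc d + suc (suc c) ≡ suc M
      sum = trans (ℕ.+-suc (suc d) (suc c)) (cong suc (trans (ℕ.+-suc (suc d) c) (cong suc (ℕ.m+[n∸m]≡n d<M′))))
      c≤M : suc (suc c) ≤ suc M
      c≤M = ℕ.m+n≤o⇒n≤o (suc d) (ℕ.≤-reflexive sum)

  N-chain⇒C : ∀ {p q} → SelfOverlapFree p → SelfOverlapFree q → (∀ k → N-chain p k ≡ N-chain q k) → ∀ t n → C M p t n ≡ C M q t n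
  N-chain⇒C {p} {q} p-free q-free eq t n = ∑-cong-All (clusters-Cluster M 1 n) λ {s} c → cong (weight t s *ᶻ_) (same c)
    where
    same : ∀ {s} → Cluster M 1 n s → N M p n s ≡ N M q n s
    same c with Cluster-cases c
    ... | inj₁ (k , refl , refl) = trans (sym (N-chain-def p k)) (trans (eq k) (N-chain-def q k))
    ... | inj₂ (inj₂ o)          = ∑-cong (permutations n) λ σ →
      trans (Overlap-occ p-free o (val σ)) (sym (Overlap-occ q-free o (val σ)))

filter-last : ∀ {P : ℕ → Set} (P? : Decidable P) k (h : ℕ → ℕ) → (∀ i → i < k → ¬ P (h i)) → P (h k) →
              filter P? (applyUpTo h (suc k)) ≡ h k ∷ []
filter-last P? zero    h no-other yes-k = List.filter-accept P? yes-k
filter-last P? (suc k) h no-other yes-k = trans (List.filter-reject P? (no-other 0 z<s))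
  (filter-last P? k (h ∘ suc) (λ i i<k → no-other (suc i) (s≤s i<k)) yes-k)

SelfOverlapFree⇒NonOverlapping : ∀ {M′} (π : Permutation′ (suc (suc M′))) → SelfOverlapFree M′ (val π) → NonOverlapping π
SelfOverlapFree⇒NonOverlapping {M′} π free = filter-last
  (λ i → st (oneLine π [ suc i ⋯ m ]) ≟ʷ st (oneLine π [ 1 ⋯ m ∸ i ])) M′ suc
  (λ d d<M′ eq → let c = M′ ∸ suc d
                     sum = trans (ℕ.+-suc (suc d) (suc c)) (cong suc (trans (ℕ.+-suc (suc d) c) (cong suc (ℕ.m+[n∸m]≡n d<M′))))
                 in free d c sum (overlap⇒Iso (suc d) (suc (suc c)) sum eq))
  (Iso⇒overlap (suc M′) 1 (ℕ.+-comm (suc M′) 1) (iso λ { zero zero _ _ → trans (≤⇒<ᵇ≡false {val π (suc M′ + 0)} ℕ.≤-refl) (sym (≤⇒<ᵇ≡false {val π 0} ℕ.≤-refl)) ; _ (suc k) _ (s≤s ()) ; (suc j) _ (s≤s ()) _ }))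
  where
  m : ℕ
  m = suc (suc M′)
  w : ℕ → ℕ
  w = suc ∘ val π

  suffix : ∀ i c → i + c ≡ m → oneLine π [ suc i ⋯ m ] ≡ applyUpTo (w ∘ (i +_)) c
  suffix i c sum = trans (cong (λ v → drop i (take m v)) (oneLine≡applyUpTo π))
    (trans (cong (λ k → drop i (take k (applyUpTo w m))) (sym sum)) (factor-applyUpTo i w (ℕ.≤-reflexive sum)))

  prefix : ∀ i c → i + c ≡ m → oneLine π [ 1 ⋯ m ∸ i ] ≡ applyUpTo w c
  prefix i c sum = trans (cong₂ take (trans (cong (_∸ i) (sym sum)) (ℕ.m+n∸m≡n i c)) (oneLine≡applyUpTo π))
    (take-applyUpTo w (ℕ.m+n≤o⇒n≤o i (ℕ.≤-reflexive sum)))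

  overlap⇒Iso : ∀ i c → i + c ≡ m → st (oneLine π [ suc i ⋯ m ]) ≡ st (oneLine π [ 1 ⋯ m ∸ i ]) → Iso c (val π ∘ (i +_)) (val π)
  overlap⇒Iso i c sum eq = st≡⇒Iso c (trans (cong st (sym (suffix i c sum))) (trans eq (cong st (prefix i c sum))))

  Iso⇒overlap : ∀ i c → i + c ≡ m → Iso c (val π ∘ (i +_)) (val π) → st (oneLine π [ suc i ⋯ m ]) ≡ st (oneLine π [ 1 ⋯ m ∸ i ])
  Iso⇒overlap i c sum i′ = trans (cong st (suffix i c sum)) (trans (Iso⇒st≡ c i′) (cong st (sym (prefix i c sum))))

-- Patterns with equal end entries

Iso-∘ : ∀ {n f g} (h : ℕ → ℕ) → (∀ x → x < n → h x < n) → Iso n f g → Iso n (f ∘ h) (g ∘ h)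
Iso-∘ h bd i = iso λ j k j<n k<n → cmp i (h j) (h k) (bd j j<n) (bd k k<n)

module _ {M′ : ℕ} (π τ : Permutation′ (suc (suc M′)))
         (first : val π 0 ≡ val τ 0) (last : val π (suc M′) ≡ val τ (suc M′)) where

  private
    M : ℕ
    M = suc M′
    p q : ℕ → ℕ
    p = val π
    q = val τ
    A : Permutation′ (suc M)
    A = τ ∘ₚ flip π
    α = val A

    p∘α : ∀ {x} → x < suc M → p (α x) ≡ q x
    p∘α x<m = trans (cong p (val-∘ₚ τ (flip π) x<m)) (val-flipˡ π (val-< τ x<m))

    α-0 : α 0 ≡ 0
    α-0 = val-inj π (val-< A z<s) z<s (trans (p∘α z<s) (sym first))

    α-M : α M ≡ M
    α-M = val-inj π (val-< A ℕ.≤-refl) ℕ.≤-refl (trans (p∘α ℕ.≤-refl) (sym last))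

    α-< : ∀ {x} → x < M → α x < M
    α-< x<M = ℕ.≤∧≢⇒< (s≤s⁻¹ (val-< A (ℕ.m≤n⇒m≤1+n x<M)))
      λ eq → ℕ.<⇒≢ x<M (val-inj A (ℕ.m≤n⇒m≤1+n x<M) ℕ.≤-refl (trans eq (sym α-M)))

  -- Rearranges every block of a chain by the permutation that carries π to τ. Blocks
  -- overlap in their end points, which that permutation fixes.
  blockwise : ℕ → ℕ → ℕ
  blockwise zero    x = x
  blockwise (suc k) x = if x <ᵇ M then α x else M + blockwise k (x ∸ M)

  private
    blockwise-< : ∀ k {x} → x < M → blockwise (suc k) x ≡ α x
    blockwise-< k x<M rewrite <⇒<ᵇ≡true x<M = refl

    blockwise-+ : ∀ k x → blockwise (suc k) (M + x) ≡ M + blockwise k x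
    blockwise-+ k x rewrite ≤⇒<ᵇ≡false {M + x} {M} (ℕ.m≤m+n M x) | ℕ.m+n∸m≡n M x = refl

    blockwise-0 : ∀ k → blockwise k 0 ≡ 0
    blockwise-0 zero    = refl
    blockwise-0 (suc k) = α-0

    split : ∀ x → x < M ⊎ ∃ λ y → x ≡ M + y
    split x with x ℕ.<? M
    ... | yes x<M = inj₁ x<M
    ... | no x≮M  = inj₂ (x ∸ M , sym (ℕ.m+[n∸m]≡n (ℕ.≮⇒≥ x≮M)))

    blockwise-bound : ∀ k {x} → x < suc (k * M) → blockwise k x < suc (k * M)
    blockwise-bound zero    lt = lt
    blockwise-bound (suc k) {x} lt with split x
    ... | inj₁ x<M      = subst (_< suc (M + k * M)) (sym (blockwise-< k x<M)) (ℕ.m≤n⇒m≤1+n (ℕ.<-≤-trans (α-< x<M) (ℕ.m≤m+n M (k * M))))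
    ... | inj₂ (y , refl) = subst (_< suc (M + k * M)) (sym (blockwise-+ k y))
      (s≤s (ℕ.+-monoʳ-≤ M (s≤s⁻¹ (blockwise-bound k (s≤s (ℕ.+-cancelˡ-≤ M y (k * M) (s≤s⁻¹ lt)))))))

    blockwise-inj : ∀ k {x y} → blockwise k x ≡ blockwise k y → x ≡ y
    blockwise-inj zero    eq = eq
    blockwise-inj (suc k) {x} {y} eq with split x | split y
    ... | inj₁ x<M | inj₁ y<M = val-inj A (ℕ.m≤n⇒m≤1+n x<M) (ℕ.m≤n⇒m≤1+n y<M)
      (trans (sym (blockwise-< k x<M)) (trans eq (blockwise-< k y<M)))
    ... | inj₁ x<M | inj₂ (v , refl) = contradiction
      (ℕ.≤-trans (ℕ.m≤m+n M _) (ℕ.≤-reflexive (trans (sym (blockwise-+ k v)) (trans (sym eq) (blockwise-< k x<M))))) (ℕ.<⇒≱ (α-< x<M))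
    ... | inj₂ (u , refl) | inj₁ y<M = contradiction
      (ℕ.≤-trans (ℕ.m≤m+n M _) (ℕ.≤-reflexive (trans (sym (blockwise-+ k u)) (trans eq (blockwise-< k y<M))))) (ℕ.<⇒≱ (α-< y<M))
    ... | inj₂ (u , refl) | inj₂ (v , refl) = cong (M +_) (blockwise-inj k (ℕ.+-cancelˡ-≡ M _ _
      (trans (sym (blockwise-+ k u)) (trans eq (blockwise-+ k v)))))

    -- Position M is treated as the start of the next block; this agrees with `α` because `α` fixes
    -- M and every block rearrangement fixes 0.
    blockwise-first : ∀ k → blockwise (suc k) ≡[ suc M ] α
    blockwise-first k x x<m with ℕ.m≤n⇒m<n∨m≡n (s≤s⁻¹ x<m)
    ... | inj₁ x<M  = blockwise-< k x<M
    ... | inj₂ refl = trans (cong (blockwise (suc k)) (sym (ℕ.+-identityʳ M))) (trans (blockwise-+ k 0)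
      (trans (cong (M +_) (blockwise-0 k)) (trans (ℕ.+-identityʳ M) (sym α-M))))

    -- Because `p ∘ α` is `q`, a window ordered like p becomes one ordered like q when its positions
    -- are rearranged by `α`, and conversely.
    e-blockwise : ∀ k f → e M p f ≡ e M q (f ∘ blockwise (suc k))
    e-blockwise k f = trans (ind-cong (iso? (suc M) f p) (iso? (suc M) (f ∘ α) q) to from)
      (e-Inv M q (Iso-refl λ x x<m → cong f (sym (blockwise-first k x x<m))))
      where
      to : Iso (suc M) f p → Iso (suc M) (f ∘ α) q
      to i = Iso-trans (Iso-∘ α (λ x → val-< A) i) (Iso-refl λ x → p∘α)
      from : Iso (suc M) (f ∘ α) q → Iso (suc M) f p
      from i = Iso-trans (Iso-refl λ x x<m → cong f (sym (val-flipˡ A x<m)))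
        (Iso-trans (Iso-∘ (val (flip A)) (λ x → val-< (flip A)) (Iso-trans i (Iso-refl λ x x<m → sym (p∘α x<m))))
          (Iso-refl λ x x<m → cong p (val-flipˡ A x<m)))

    occ-cong : ∀ p s {f g} → (∀ x → f x ≡ g x) → occ M p s f ≡ occ M p s g
    occ-cong p []      eq = refl
    occ-cong p (true ∷ s)  eq = cong₂ _*ᶻ_ (e-Inv M p (Iso-refl λ x _ → eq x)) (occ-cong p s (eq ∘ suc))
    occ-cong p (false ∷ s) eq = cong (1ℤ *ᶻ_) (occ-cong p s (eq ∘ suc))

    occ-blockwise : ∀ k f → occ M p (chain M′ 0 k) f ≡ occ M q (chain M′ 0 k) (f ∘ blockwise k)
    occ-blockwise zero    f = refl
    occ-blockwise (suc k) f = cong₂ _*ᶻ_ (e-blockwise k f) (begin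
      occ M p (chain M′ M′ k) (f ∘ suc)                        ≡⟨ occ-chain M′ p M′ k (f ∘ suc) ⟩
      occ M p (chain M′ 0 k) (f ∘ (M +_))                      ≡⟨ occ-blockwise k (f ∘ (M +_)) ⟩
      occ M q (chain M′ 0 k) (f ∘ (M +_) ∘ blockwise k)        ≡⟨ occ-cong q (chain M′ 0 k) (λ x → cong f (sym (blockwise-+ k x))) ⟩
      occ M q (chain M′ 0 k) (f ∘ blockwise (suc k) ∘ (M +_))  ≡⟨ occ-chain M′ q M′ k (f ∘ blockwise (suc k) ∘ suc) ⟨
      occ M q (chain M′ M′ k) (f ∘ blockwise (suc k) ∘ suc)    ∎)
      where open ≡-Reasoning

  -- `blockwise k` permutes the positions of the chain, so composing every summand with it leaves
  -- the sum unchanged.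
  N-chain-ends : ∀ k → N-chain M′ p k ≡ N-chain M′ q k
  N-chain-ends k = trans (N-chain-def M′ p k) (trans (S-cong n {occ M p s} {λ f → occ M q s (f ∘ blockwise k)} (occ-blockwise k))
    (trans (∑-cong (permutations n) λ σ → inv (Iso-refl λ x x<n → cong (val σ) (sym (proj₂ ρ x x<n))))
      (trans (S-∘ʳ {n} {occ M q s} inv (proj₁ ρ)) (sym (N-chain-def M′ q k)))))
    where
    n = suc (k * M)
    s = chain M′ 0 k
    c = chain-Cluster M′ 0 k
    inv : Inv n (occ M q s)
    inv = subst (λ n → Inv n (occ M q s)) (Cluster-length M c) (occ-Inv M q s (Cluster-Fits M c))
    ρ = bounded-injective⇒permutation n (blockwise k) (blockwise-bound k) (λ _ _ → blockwise-inj k)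

-- Two linked copies of a permutation

ind-mono : ∀ {P Q : Set} (P? : Dec P) (Q? : Dec Q) → (P → Q) → ind P? ≤ᶻ ind Q?
ind-mono (no _)  Q? f = 0≤ind Q?
ind-mono (yes p) Q? f = ℤ.≤-reflexive (sym (ind-yes Q? (f p)))

ind-+-≤ : ∀ {P Q R : Set} (P? : Dec P) (Q? : Dec Q) (R? : Dec R) → (P → R) → (Q → R) → (P → Q → ⊥) →
          ind P? +ᶻ ind Q? ≤ᶻ ind R?
ind-+-≤ (yes p) (yes q) R? f g excl = ⊥-elim (excl p q)
ind-+-≤ (yes p) (no _)  R? f g excl = ℤ.≤-reflexive (sym (ind-yes R? (f p)))
ind-+-≤ (no _)  (yes q) R? f g excl = ℤ.≤-reflexive (sym (ind-yes R? (g q)))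
ind-+-≤ (no _)  (no _)  R? f g excl = 0≤ind R?

ind-* : ∀ {P Q : Set} (P? : Dec P) (Q? : Dec Q) → ind P? *ᶻ ind Q? ≡ ind (P? ×-dec Q?)
ind-* (no _)  (no _)  = refl
ind-* (no _)  (yes _) = refl
ind-* (yes _) (no _)  = refl
ind-* (yes _) (yes _) = refl

module _ {M′ : ℕ} (π : Permutation′ (suc (suc M′))) where

  private
    M n A B : ℕ
    M = suc M′
    n = suc (2 * M)
    A = val π 0
    B = val π M

    p : ℕ → ℕ
    p = val π

    A≤M : A ≤ M
    A≤M = s≤s⁻¹ (val-< π z<s)
    B≤M : B ≤ M
    B≤M = s≤s⁻¹ (val-< π ℕ.≤-refl)

    2M≡M+M : 2 * M ≡ M + M
    2M≡M+M = cong (M +_) (ℕ.+-identityʳ M)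

  Linked : (ℕ → ℕ) → Set
  Linked f = Iso (suc M) f p × Iso (suc M) (f ∘ (M +_)) p

  linked? : ∀ f → Dec (Linked f)
  linked? f = iso? (suc M) f p ×-dec iso? (suc M) (f ∘ (M +_)) p

  Linked-resp : ∀ {f g} → Iso n f g → Linked f → Linked g
  Linked-resp i (i₁ , i₂) =
    Iso-trans (Iso-sym (Iso-weaken (s≤s (ℕ.m≤m+n M (M + 0))) i)) i₁ ,
    Iso-trans (Iso-sym (Iso-shift M (ℕ.≤-reflexive (trans (ℕ.+-suc M M) (cong suc (sym 2M≡M+M)))) i)) i₂

  N-chain-2 : N-chain M′ p 2 ≡ ∑ₚ n (λ σ → ind (linked? (val σ)))
  N-chain-2 = trans (N-chain-def M′ p 2) (S-cong n {occ M p (chain M′ 0 2)} λ f → trans (cong (e M p f *ᶻ_) (trans (occ-chain M′ p M′ 1 (f ∘ suc))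
    (trans (cong (e M p (f ∘ (M +_)) *ᶻ_) (occ-chain M′ p M′ 0 (f ∘ (M +_) ∘ suc))) (ℤ.*-identityʳ (e M p (f ∘ (M +_)))))))
    (ind-* (iso? (suc M) f p) (iso? (suc M) (f ∘ (M +_)) p)))

  private
    StrictMono : (ℕ → ℕ) → Set
    StrictMono u = ∀ {x y} → x < y → u x < u y

    mono⇒Iso : ∀ {u f g k} → StrictMono u → f ≡[ k ] u ∘ g → Iso k f g
    mono⇒Iso {u} {f} {g} mono eq = Iso-trans (Iso-refl eq) (iso λ i j _ _ → <ᵇ-cong back mono)
      where
      back : ∀ {x y} → u x < u y → x < y
      back {x} {y} lt with ℕ.<-cmp x y
      ... | tri< x<y _ _  = x<y
      ... | tri≈ _ refl _ = contradiction lt (ℕ.<-irrefl refl)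
      ... | tri> _ _ y<x  = contradiction lt (ℕ.<-asym (mono y<x))

    mono⇒inj : ∀ {u x y} → StrictMono u → u x ≡ u y → x ≡ y
    mono⇒inj {u} {x} {y} mono eq with ℕ.<-cmp x y
    ... | tri< x<y _ _ = contradiction eq (ℕ.<⇒≢ (mono x<y))
    ... | tri≈ _ x≡y _ = x≡y
    ... | tri> _ _ y<x = contradiction (sym eq) (ℕ.<⇒≢ (mono y<x))

  -- Two copies of π sharing the entry A + B. Below it come the B smaller entries of the first
  -- copy and then the A smaller ones of the second copy; c and d shift the larger entries.
  module Glue (c d : ℕ) (A≤c : A ≤ c) (B≤d : B ≤ d)
              (apart : ∀ {x y} → B < x → x ≤ M → A < y → y ≤ M → c + x ≢ d + y) where

    u v : ℕ → ℕ
    u x = if x <ᵇ B then x else (if B <ᵇ x then c + x else A + x)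
    v y = if A <ᵇ y then d + y else B + y

    private
      u-< : ∀ {x} → x < B → u x ≡ x
      u-< lt rewrite <⇒<ᵇ≡true lt = refl

      u-≡ : u B ≡ A + B
      u-≡ rewrite ≤⇒<ᵇ≡false {B} {B} ℕ.≤-refl = refl

    u-> : ∀ {x} → B < x → u x ≡ c + x
    u-> {x} lt rewrite ≤⇒<ᵇ≡false {x} {B} (ℕ.<⇒≤ lt) | <⇒<ᵇ≡true lt = refl

    v-> : ∀ {y} → A < y → v y ≡ d + y
    v-> lt rewrite <⇒<ᵇ≡true lt = refl

    private
      v-≤ : ∀ {y} → y ≤ A → v y ≡ B + y
      v-≤ {y} le rewrite ≤⇒<ᵇ≡false {A} {y} le = refl

      u-mono : StrictMono u
      u-mono {x} {y} x<y with ℕ.<-cmp x B | ℕ.<-cmp y B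
      ... | tri< a _ _    | tri< b _ _    = subst₂ _<_ (sym (u-< a)) (sym (u-< b)) x<y
      ... | tri< a _ _    | tri≈ _ refl _ = subst₂ _<_ (sym (u-< a)) (sym u-≡) (ℕ.<-≤-trans x<y (ℕ.m≤n+m B A))
      ... | tri< a _ _    | tri> _ _ b    = subst₂ _<_ (sym (u-< a)) (sym (u-> b)) (ℕ.<-≤-trans x<y (ℕ.m≤n+m y c))
      ... | tri≈ _ refl _ | tri< b _ _    = contradiction b (ℕ.<-asym x<y)
      ... | tri≈ _ refl _ | tri≈ _ refl _ = contradiction x<y (ℕ.<-irrefl refl)
      ... | tri≈ _ refl _ | tri> _ _ b    = subst₂ _<_ (sym u-≡) (sym (u-> b)) (ℕ.+-mono-≤-< A≤c x<y)
      ... | tri> _ _ a    | tri< b _ _    = contradiction (ℕ.<-trans a x<y) (ℕ.<-asym b)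
      ... | tri> _ _ a    | tri≈ _ refl _ = contradiction a (ℕ.<-asym x<y)
      ... | tri> _ _ a    | tri> _ _ b    = subst₂ _<_ (sym (u-> a)) (sym (u-> b)) (ℕ.+-monoʳ-< c x<y)

      v-mono : StrictMono v
      v-mono {x} {y} x<y with x ℕ.≤? A | y ℕ.≤? A
      ... | yes a | yes b = subst₂ _<_ (sym (v-≤ a)) (sym (v-≤ b)) (ℕ.+-monoʳ-< B x<y)
      ... | yes a | no ¬b = subst₂ _<_ (sym (v-≤ a)) (sym (v-> (ℕ.≰⇒> ¬b))) (ℕ.+-mono-≤-< B≤d x<y)
      ... | no ¬a | yes b = contradiction (ℕ.≤-trans (ℕ.<⇒≤ x<y) b) ¬a
      ... | no ¬a | no ¬b = subst₂ _<_ (sym (v-> (ℕ.≰⇒> ¬a))) (sym (v-> (ℕ.≰⇒> ¬b))) (ℕ.+-monoʳ-< d x<y)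

      B≤v : ∀ y → B ≤ v y
      B≤v y with y ℕ.≤? A
      ... | yes a = subst (B ≤_) (sym (v-≤ a)) (ℕ.m≤m+n B y)
      ... | no ¬a = subst (B ≤_) (sym (v-> (ℕ.≰⇒> ¬a))) (ℕ.≤-trans B≤d (ℕ.m≤m+n d y))

      uB≡vA : u B ≡ v A
      uB≡vA = trans u-≡ (trans (ℕ.+-comm A B) (sym (v-≤ ℕ.≤-refl)))

      -- Values of `u` at entries below B stay under B, where `v` begins; above the shared value
      -- only the upper parts remain, and `apart` separates these.
      meet : ∀ {x y} → x ≤ M → y ≤ M → u x ≡ v y → x ≡ B
      meet {x} {y} x≤M y≤M eq with ℕ.<-cmp x B
      ... | tri< a _ _ = contradiction (subst (B ≤_) (trans (sym eq) (u-< a)) (B≤v y)) (ℕ.<⇒≱ a)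
      ... | tri≈ _ a _ = a
      ... | tri> _ _ a with y ℕ.≤? A
      ...   | yes b = contradiction (subst₂ _<_ uB≡vA eq (u-mono a)) (ℕ.≤⇒≯ (subst₂ _≤_ (sym (v-≤ b)) (sym (v-≤ ℕ.≤-refl)) (ℕ.+-monoʳ-≤ B b)))
      ...   | no ¬b = contradiction (trans (sym (u-> a)) (trans eq (v-> (ℕ.≰⇒> ¬b)))) (apart a x≤M (ℕ.≰⇒> ¬b) y≤M)

    glue : ℕ → ℕ
    glue x = if x <ᵇ M then u (p x) else v (p (x ∸ M))

    glue-< : ∀ {x} → x < M → glue x ≡ u (p x)
    glue-< x<M rewrite <⇒<ᵇ≡true x<M = refl

    glue-+ : ∀ x → glue (M + x) ≡ v (p x)
    glue-+ x rewrite ≤⇒<ᵇ≡false {M + x} {M} (ℕ.m≤m+n M x) | ℕ.m+n∸m≡n M x = refl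

    glue-Linked : Linked glue
    glue-Linked = mono⇒Iso u-mono first , mono⇒Iso v-mono (λ x _ → glue-+ x)
      where
      first : glue ≡[ suc M ] u ∘ p
      first x x<m with ℕ.m≤n⇒m<n∨m≡n (s≤s⁻¹ x<m)
      ... | inj₁ x<M  = glue-< x<M
      ... | inj₂ refl = trans (cong glue (sym (ℕ.+-identityʳ M))) (trans (glue-+ 0) (sym uB≡vA))

    glue-inj : Inj n glue
    glue-inj {j} {k} j<n k<n eq with split j j<n | split k k<n
      where
      split : ∀ x → x < n → x < M ⊎ ∃ λ y → y ≤ M × x ≡ M + y
      split x x<n with x ℕ.<? M
      ... | yes x<M = inj₁ x<M
      ... | no x≮M  = inj₂ (x ∸ M , ℕ.+-cancelˡ-≤ M _ _
        (subst₂ _≤_ (sym (ℕ.m+[n∸m]≡n (ℕ.≮⇒≥ x≮M))) 2M≡M+M (s≤s⁻¹ x<n)) , sym (ℕ.m+[n∸m]≡n (ℕ.≮⇒≥ x≮M)))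
    ... | inj₁ a | inj₁ b = val-inj π (ℕ.m≤n⇒m≤1+n a) (ℕ.m≤n⇒m≤1+n b)
      (mono⇒inj u-mono (trans (sym (glue-< a)) (trans eq (glue-< b))))
    ... | inj₁ a | inj₂ (y , b , refl) = contradiction (val-inj π (ℕ.m≤n⇒m≤1+n a) ℕ.≤-refl
      (meet (s≤s⁻¹ (val-< π (ℕ.m≤n⇒m≤1+n a))) (s≤s⁻¹ (val-< π (s≤s b))) (trans (sym (glue-< a)) (trans eq (glue-+ y))))) (ℕ.<⇒≢ a)
    ... | inj₂ (x , a , refl) | inj₁ b = contradiction (val-inj π (ℕ.m≤n⇒m≤1+n b) ℕ.≤-refl
      (meet (s≤s⁻¹ (val-< π (ℕ.m≤n⇒m≤1+n b))) (s≤s⁻¹ (val-< π (s≤s a))) (trans (sym (glue-< b)) (trans (sym eq) (glue-+ x))))) (ℕ.<⇒≢ b)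
    ... | inj₂ (x , a , refl) | inj₂ (y , b , refl) = cong (M +_) (val-inj π (s≤s a) (s≤s b)
      (mono⇒inj v-mono (trans (sym (glue-+ x)) (trans eq (glue-+ y)))))

    glued : Permutation′ n
    glued = proj₁ (standardize n glue glue-inj)

    glued-Iso : Iso n (val glued) glue
    glued-Iso = proj₂ (standardize n glue glue-inj)

    glued-Linked : Linked (val glued)
    glued-Linked = Linked-resp (Iso-sym glued-Iso) glue-Linked

  private
    -- The upper entries of the first copy end at A + M, and those of the second start above it;
    -- `High` exchanges the roles of the copies.
    module Low  = Glue A M ℕ.≤-refl B≤M (λ {_} {y} _ x≤M A<y _ → ℕ.<⇒≢
      (ℕ.≤-<-trans (ℕ.+-monoʳ-≤ A x≤M) (subst (_< M + y) (ℕ.+-comm M A) (ℕ.+-monoʳ-< M A<y))))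
    module High = Glue M B A≤M ℕ.≤-refl (λ {x} B<x _ _ y≤M eq → ℕ.<⇒≢
      (ℕ.≤-<-trans (ℕ.+-monoʳ-≤ B y≤M) (subst (_< M + x) (ℕ.+-comm M B) (ℕ.+-monoʳ-< M B<x))) (sym eq))

    ≈⇒Linked : ∀ {ρ σ : Permutation′ n} → Linked (val ρ) → ρ ≈ σ → Linked (val σ)
    ≈⇒Linked {ρ} {σ} l eq = Linked-resp (Iso-refl λ x _ → val-cong {σ = ρ} {σ} eq x) l

  -- The shared entry is the largest of the first copy and the smallest of the second, so all
  -- comparisons between the copies are forced.
  N-chain-2-extreme : p 0 ≡ 0 → p M ≡ M → N-chain M′ p 2 ≤ᶻ 1ℤ
  N-chain-2-extreme p0 pM = ℤ.≤-trans (ℤ.≤-reflexive N-chain-2) (ℤ.≤-trans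
    (∑-mono (permutations n) λ σ → ind-mono (linked? (val σ)) (Low.glued ≈? σ)
      λ l → Iso⇒≈ {σ = Low.glued} {σ} (rigid Low.glued-Linked l))
    (ℤ.≤-reflexive (∑ₚ-≈ Low.glued)))
    where
    separated : ∀ {f} → Linked f → ∀ {j k} → j ≤ M → suc k ≤ M → f j < f (M + suc k)
    separated {f} (i₁ , i₂) {j} {k} j≤M k<M = ℕ.≤-<-trans fj≤fM (subst (λ x → f x < f (M + suc k)) (ℕ.+-identityʳ M)
      (<ᵇ-transport (sym (cmp i₂ 0 (suc k) z<s (s≤s k<M))) (subst (_< p (suc k)) (sym p0)
        (ℕ.n≢0⇒n>0 λ eq → case val-inj π (s≤s k<M) z<s (trans eq (sym p0)) of λ ()))))
      where
      fj≤fM : f j ≤ f M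
      fj≤fM with ℕ.m≤n⇒m<n∨m≡n j≤M
      ... | inj₂ refl = ℕ.≤-refl
      ... | inj₁ j<M  = ℕ.<⇒≤ (<ᵇ-transport (sym (cmp i₁ j M (s≤s j≤M) ℕ.≤-refl)) (subst (p j <_) (sym pM)
        (ℕ.≤∧≢⇒< (s≤s⁻¹ (val-< π (s≤s j≤M))) λ eq → ℕ.<⇒≢ j<M (val-inj π (s≤s j≤M) ℕ.≤-refl (trans eq (sym pM))))))

    split : ∀ x → x < n → x ≤ M ⊎ ∃ λ y → suc y ≤ M × x ≡ M + suc y
    split x x<n with x ℕ.≤? M
    ... | yes x≤M = inj₁ x≤M
    ... | no x≰M  = inj₂ (x ∸ suc M , ℕ.+-cancelˡ-≤ M _ _
      (subst₂ _≤_ x≡ 2M≡M+M (s≤s⁻¹ x<n)) , x≡)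
      where
      x≡ : x ≡ M + suc (x ∸ suc M)
      x≡ = trans (sym (ℕ.m+[n∸m]≡n (ℕ.≰⇒> x≰M))) (sym (ℕ.+-suc M (x ∸ suc M)))

    rigid : ∀ {f g} → Linked f → Linked g → Iso n f g
    rigid {f} {g} lf@(f₁ , f₂) lg@(g₁ , g₂) = iso order
      where
      order : ∀ j k → j < n → k < n → (f j <ᵇ f k) ≡ (g j <ᵇ g k)
      order j k j<n k<n with split j j<n | split k k<n
      ... | inj₁ a | inj₁ b = cmp (Iso-trans f₁ (Iso-sym g₁)) j k (s≤s a) (s≤s b)
      ... | inj₁ a | inj₂ (y , b , refl) = trans (<⇒<ᵇ≡true (separated lf a b)) (sym (<⇒<ᵇ≡true (separated lg a b)))
      ... | inj₂ (x , a , refl) | inj₁ b =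
        trans (≤⇒<ᵇ≡false (ℕ.<⇒≤ (separated lf b a))) (sym (≤⇒<ᵇ≡false (ℕ.<⇒≤ (separated lg b a))))
      ... | inj₂ (x , a , refl) | inj₂ (y , b , refl) = cmp (Iso-trans f₂ (Iso-sym g₂)) (suc x) (suc y) (s≤s a) (s≤s b)

  -- The two gluings order the two entries equal to M in opposite ways.
  N-chain-2-interior : p 0 < M → p M < M → pos 2 ≤ᶻ N-chain M′ p 2
  N-chain-2-interior A<M B<M = ℤ.≤-trans (ℤ.≤-reflexive (sym two)) (ℤ.≤-trans
    (∑-mono (permutations n) λ σ → ind-+-≤ (Low.glued ≈? σ) (High.glued ≈? σ) (linked? (val σ))
      (≈⇒Linked {Low.glued} {σ} Low.glued-Linked) (≈⇒Linked {High.glued} {σ} High.glued-Linked)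
      λ l h → different (≈-trans {ρ = Low.glued} {σ} {High.glued} l (≈-sym {σ = High.glued} {σ} h)))
    (ℤ.≤-reflexive (sym N-chain-2)))
    where
    two : ∑ₚ n (λ σ → ind (Low.glued ≈? σ) +ᶻ ind (High.glued ≈? σ)) ≡ pos 2
    two = trans (∑-+ (permutations n)) (cong₂ _+ᶻ_ (∑ₚ-≈ Low.glued) (∑ₚ-≈ High.glued))

    x : ℕ
    x = val (flip π) M

    px≡M : p x ≡ M
    px≡M = val-flipˡ π ℕ.≤-refl

    x≤M : x ≤ M
    x≤M = s≤s⁻¹ (val-< (flip π) ℕ.≤-refl)

    x<M : x < M
    x<M = ℕ.≤∧≢⇒< x≤M λ eq → ℕ.<⇒≢ B<M (trans (cong p (sym eq)) px≡M)

    x<n : x < n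
    x<n = s≤s (ℕ.≤-trans x≤M (ℕ.m≤m+n M (M + 0)))

    M+x<n : M + x < n
    M+x<n = s≤s (subst (M + x ≤_) (sym 2M≡M+M) (ℕ.+-monoʳ-≤ M x≤M))

    low : Low.glue x < Low.glue (M + x)
    low = subst₂ _<_
      (sym (trans (Low.glue-< x<M) (trans (cong Low.u px≡M) (Low.u-> B<M))))
      (sym (trans (Low.glue-+ x) (trans (cong Low.v px≡M) (Low.v-> A<M))))
      (ℕ.+-monoˡ-< M A<M)

    high : High.glue (M + x) < High.glue x
    high = subst₂ _<_
      (sym (trans (High.glue-+ x) (trans (cong High.v px≡M) (High.v-> A<M))))
      (sym (trans (High.glue-< x<M) (trans (cong High.u px≡M) (High.u-> B<M))))
      (ℕ.+-monoˡ-< M B<M)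

    different : ¬ (Low.glued ≈ High.glued)
    different eq = ℕ.<-asym high (<ᵇ-transport (cmp order x (M + x) x<n M+x<n) low)
      where
      order : Iso n Low.glue High.glue
      order = Iso-trans (Iso-sym Low.glued-Iso)
        (Iso-trans (Iso-refl λ x _ → val-cong {σ = Low.glued} {High.glued} eq x) High.glued-Iso)

-- Non-overlapping representatives

skip : ℕ → ℕ → ℕ
skip j x = if x <ᵇ j then x else suc x

skip-< : ∀ {j x} → x < j → skip j x ≡ x
skip-< lt rewrite <⇒<ᵇ≡true lt = refl

skip-≥ : ∀ {j x} → j ≤ x → skip j x ≡ suc x
skip-≥ {j} {x} le rewrite ≤⇒<ᵇ≡false {x} {j} le = refl

skip-mono : ∀ j {x y} → x < y → skip j x < skip j y
skip-mono j {x} {y} x<y with x ℕ.<? j | y ℕ.<? j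
... | yes a | yes b = subst₂ _<_ (sym (skip-< a)) (sym (skip-< b)) x<y
... | yes a | no ¬b = subst₂ _<_ (sym (skip-< a)) (sym (skip-≥ (ℕ.≮⇒≥ ¬b))) (ℕ.m≤n⇒m≤1+n x<y)
... | no ¬a | yes b = contradiction (ℕ.<-trans x<y b) ¬a
... | no ¬a | no ¬b = subst₂ _<_ (sym (skip-≥ (ℕ.≮⇒≥ ¬a))) (sym (skip-≥ (ℕ.≮⇒≥ ¬b))) (s≤s x<y)

toℕ-punchIn : ∀ {n} (j : Fin (suc n)) k → toℕ (punchIn j k) ≡ skip (toℕ j) (toℕ k)
toℕ-punchIn zero    k       = refl
toℕ-punchIn (suc j) zero    = refl
toℕ-punchIn (suc j) (suc k) with toℕ k <ᵇ toℕ j | toℕ-punchIn j k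
... | true  | eq = cong suc eq
... | false | eq = cong suc eq

val-insert-punchIn : ∀ {n} i j (ρ : Permutation′ n) {x} → x < n → val (insert i j ρ) (skip (toℕ i) x) ≡ skip (toℕ j) (val ρ x)
val-insert-punchIn i j ρ {x} x<n = begin
  val (insert i j ρ) (skip (toℕ i) x)                   ≡⟨ cong (λ y → val (insert i j ρ) (skip (toℕ i) y)) (Fin.toℕ-fromℕ< x<n) ⟨
  val (insert i j ρ) (skip (toℕ i) (toℕ (fromℕ< x<n)))  ≡⟨ cong (val (insert i j ρ)) (toℕ-punchIn i (fromℕ< x<n)) ⟨
  val (insert i j ρ) (toℕ (punchIn i (fromℕ< x<n)))     ≡⟨ val-toℕ (insert i j ρ) _ ⟩
  toℕ (insert i j ρ ⟨$⟩ʳ punchIn i (fromℕ< x<n))        ≡⟨ cong toℕ (insert-punchIn i j ρ (fromℕ< x<n)) ⟩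
  toℕ (punchIn j (ρ ⟨$⟩ʳ fromℕ< x<n))                   ≡⟨ toℕ-punchIn j _ ⟩
  skip (toℕ j) (toℕ (ρ ⟨$⟩ʳ fromℕ< x<n))                ≡⟨ cong (skip (toℕ j)) (ext-fromℕ< _ x<n) ⟨
  skip (toℕ j) (val ρ x)                                ∎
  where open ≡-Reasoning

val-insert-at : ∀ {n} i j (ρ : Permutation′ n) → val (insert i j ρ) (toℕ i) ≡ toℕ j
val-insert-at i j ρ = trans (val-toℕ (insert i j ρ) i) (cong toℕ here≡)
  where
  here≡ : insert i j ρ ⟨$⟩ʳ i ≡ j
  here≡ with i Fin.≟ i
  ... | yes _   = refl
  ... | no i≢i = contradiction refl i≢i

infixr 5 _◂_
infixl 5 _▸_

abstract

  -- Prepends the entry j and raises the entries from j on by one, as `_▸_` does at the other end.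
  -- Representatives assembled in this way are permutations by construction.
  _◂_ : ∀ {n j} → j ≤ n → Permutation′ n → Permutation′ (suc n)
  j≤n ◂ ρ = insert zero (fromℕ< (s≤s j≤n)) ρ

  val-◂-0 : ∀ {n j} (j≤n : j ≤ n) (ρ : Permutation′ n) → val (j≤n ◂ ρ) 0 ≡ j
  val-◂-0 j≤n ρ = Fin.toℕ-fromℕ< (s≤s j≤n)

  val-◂-suc : ∀ {n j} (j≤n : j ≤ n) (ρ : Permutation′ n) {x} → x < n → val (j≤n ◂ ρ) (suc x) ≡ skip j (val ρ x)
  val-◂-suc j≤n ρ {x} x<n = trans (val-insert-punchIn zero _ ρ x<n) (cong (λ j → skip j (val ρ x)) (Fin.toℕ-fromℕ< (s≤s j≤n)))

  _▸_ : ∀ {n j} → Permutation′ n → j ≤ n → Permutation′ (suc n)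
  _▸_ {n} ρ j≤n = insert (fromℕ n) (fromℕ< (s≤s j≤n)) ρ

  val-▸-< : ∀ {n j} (ρ : Permutation′ n) (j≤n : j ≤ n) {x} → x < n → val (ρ ▸ j≤n) x ≡ skip j (val ρ x)
  val-▸-< {n} ρ j≤n {x} x<n = trans
    (cong (val (ρ ▸ j≤n)) (sym (trans (cong (λ i → skip i x) (Fin.toℕ-fromℕ n)) (skip-< x<n))))
    (trans (val-insert-punchIn (fromℕ n) _ ρ x<n) (cong (λ j → skip j (val ρ x)) (Fin.toℕ-fromℕ< (s≤s j≤n))))

  val-▸-last : ∀ {n j} (ρ : Permutation′ n) (j≤n : j ≤ n) → val (ρ ▸ j≤n) n ≡ j
  val-▸-last {n} ρ j≤n = trans (cong (val (ρ ▸ j≤n)) (sym (Fin.toℕ-fromℕ n)))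
    (trans (val-insert-at (fromℕ n) _ ρ) (Fin.toℕ-fromℕ< (s≤s j≤n)))

Representative : ℕ → ℕ → ℕ → Set
Representative M′ A B = Σ[ ρ ∈ Permutation′ (2 + M′) ] val ρ 0 ≡ A × val ρ (suc M′) ≡ B × SelfOverlapFree M′ (val ρ)

Iso-< : ∀ {n f g} → Iso n f g → ∀ {j k} → j < n → k < n → f j < f k → g j < g k
Iso-< i j<n k<n = <ᵇ-transport (cmp i _ _ j<n k<n)

-- 1 2 ⋯ b-1 b+1 ⋯ m b: every proper prefix is increasing.
increasing-representative : ∀ M′ B → 0 < B → B < suc M′ → Representative M′ 0 B
increasing-representative M′ B 0<B B<M = ρ , trans (h-< z<s) (skip-< 0<B) , h-last , free
  where
  M : ℕ
  M = suc M′
  ρ : Permutation′ (suc M)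
  ρ = id ▸ ℕ.<⇒≤ B<M
  h : ℕ → ℕ
  h = val ρ

  h-< : ∀ {x} → x < M → h x ≡ skip B x
  h-< x<M = trans (val-▸-< id (ℕ.<⇒≤ B<M) x<M) (cong (skip B) (val-id x<M))

  h-last : h M ≡ B
  h-last = val-▸-last id (ℕ.<⇒≤ B<M)

  free : SelfOverlapFree M′ h
  free d c sum i = ℕ.<-asym ascent (Iso-< i ℕ.≤-refl (ℕ.m≤n⇒m≤1+n ℕ.≤-refl) descent)
    where
    d+c : suc d + suc c ≡ M
    d+c = ℕ.suc-injective (trans (sym (ℕ.+-suc (suc d) (suc c))) sum)
    d+c′ : suc d + c ≡ M′
    d+c′ = ℕ.suc-injective (trans (sym (ℕ.+-suc (suc d) c)) d+c)
    c<M : suc c < M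
    c<M = subst (suc c <_) d+c (s≤s (ℕ.m≤n+m (suc c) d))

    -- Every suffix of length at least 2 ends with the descent m b.
    descent : h (suc d + suc c) < h (suc d + c)
    descent = subst₂ (λ x y → h x < h y) (sym d+c) (sym d+c′)
      (subst₂ _<_ (sym h-last) (sym (trans (h-< ℕ.≤-refl) (skip-≥ (s≤s⁻¹ B<M)))) B<M)

    ascent : h c < h (suc c)
    ascent = subst₂ _<_ (sym (h-< (ℕ.<-trans ℕ.≤-refl c<M))) (sym (h-< c<M)) (skip-mono B ℕ.≤-refl)

-- 2 1 m 3 4 ⋯ m-1 for m ≥ 5.
edge-representative : ∀ K → Representative (3 + K) 1 (3 + K)
edge-representative K = ρ , h-0 , h-last , free
  where
  ρ₁ : Permutation′ (3 + K)
  ρ₁ = ℕ.≤-refl ◂ id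
  ρ₂ : Permutation′ (4 + K)
  ρ₂ = z≤n ◂ ρ₁
  ρ : Permutation′ (5 + K)
  ρ = s≤s z≤n ◂ ρ₂
  h : ℕ → ℕ
  h = val ρ

  h-0 : h 0 ≡ 1
  h-0 = val-◂-0 (s≤s z≤n) ρ₂

  h-1 : h 1 ≡ 0
  h-1 = trans (val-◂-suc (s≤s z≤n) ρ₂ z<s) (cong (skip 1) (val-◂-0 z≤n ρ₁))

  h-suc-suc : ∀ {x} → x < 3 + K → h (2 + x) ≡ suc (suc (val ρ₁ x))
  h-suc-suc x< = trans (val-◂-suc (s≤s z≤n) ρ₂ (s≤s x<)) (trans (cong (skip 1) (val-◂-suc z≤n ρ₁ x<)) refl)

  h-2 : h 2 ≡ 4 + K
  h-2 = trans (h-suc-suc z<s) (cong (2 +_) (val-◂-0 ℕ.≤-refl (id {2 + K})))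

  h-3+ : ∀ {x} → x < 2 + K → h (3 + x) ≡ 2 + x
  h-3+ {x} x< = trans (h-suc-suc (s≤s x<)) (cong (2 +_) (trans (val-◂-suc ℕ.≤-refl (id {2 + K}) x<)
    (trans (cong (skip (2 + K)) (val-id x<)) (skip-< x<))))

  h-last : h (4 + K) ≡ 3 + K
  h-last = h-3+ ℕ.≤-refl

  down : h 1 < h 0
  down = subst₂ _<_ (sym h-1) (sym h-0) z<s

  free : SelfOverlapFree (3 + K) h
  -- An overlap would have to start with a descent, as 2 1 does; the only other descent is m 3.
  free d c sum i with Iso-< (Iso-sym i) (s≤s z<s) z<s down
  free zero c sum i | lt = ℕ.<-asym lt (subst₂ _<_ (sym h-1) (sym h-2) z<s)
  -- The overlap has length m - 2, which is at least 3 because m ≥ 5, so the prefix 2 1 m demands an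
  -- entry above the maximum.
  free (suc zero) (suc c) sum i | lt = ℕ.<-asym
    (Iso-< (Iso-sym i) z<s (s≤s (s≤s z<s)) (subst₂ _<_ (sym h-0) (sym h-2) (s≤s z<s)))
    (subst₂ _<_ (sym (h-3+ {1} (s≤s z<s))) (sym h-2) (s≤s (s≤s (s≤s (s≤s z≤n)))))
  free (suc (suc d)) c sum i | lt = ℕ.<-asym lt
    (subst₂ _<_ (sym (h-3+ (ℕ.<-trans (ℕ.+-monoʳ-< d z<s) y<))) (sym (h-3+ y<)) (s≤s (s≤s (ℕ.+-monoʳ-< d z<s))))
    where
    y< : d + 1 < 2 + K
    y< = ℕ.≤-trans (ℕ.≤-trans (ℕ.≤-reflexive (sym (ℕ.+-suc d 1))) (ℕ.+-monoʳ-≤ d (s≤s (s≤s (z≤n {c})))))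
      (ℕ.≤-reflexive (ℕ.suc-injective (ℕ.suc-injective (ℕ.suc-injective sum))))

-- a m 1 L b+1 b with L increasing: an overlap of length at least 3 would be an occurrence of
-- 231 at its start, and the remaining entries exclude all of these.
central-representative : ∀ K A J → 1 ≤ A → A ≤ suc J → J ≤ K → Representative (3 + K) A (2 + J)
central-representative K A J 1≤A A≤1+J J≤K = ρ , h-0 , h-last , free
  where
  ρ₁ : Permutation′ (2 + K)
  ρ₁ = id ▸ J≤K ▸ ℕ.m≤n⇒m≤1+n J≤K
  ρ₂ : Permutation′ (3 + K)
  ρ₂ = z≤n ◂ ρ₁
  ρ₃ : Permutation′ (4 + K)
  ρ₃ = ℕ.≤-refl ◂ ρ₂
  A≤ : A ≤ 4 + K
  A≤ = ℕ.≤-trans A≤1+J (s≤s (ℕ.≤-trans J≤K (ℕ.m≤n+m K 3)))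
  ρ : Permutation′ (5 + K)
  ρ = A≤ ◂ ρ₃
  h g : ℕ → ℕ
  h = val ρ
  g = val ρ₁

  h-0 : h 0 ≡ A
  h-0 = val-◂-0 A≤ ρ₃

  h-1 : h 1 ≡ 4 + K
  h-1 = trans (val-◂-suc A≤ ρ₃ z<s) (trans (cong (skip A) (val-◂-0 ℕ.≤-refl ρ₂))
    (skip-≥ (ℕ.≤-trans A≤1+J (s≤s (ℕ.≤-trans J≤K (ℕ.m≤n+m K 2))))))

  h-suc-suc : ∀ {x} → x < 3 + K → h (2 + x) ≡ skip A (val ρ₂ x)
  h-suc-suc {x} x< = trans (val-◂-suc A≤ ρ₃ (s≤s x<)) (cong (skip A)
    (trans (val-◂-suc ℕ.≤-refl ρ₂ x<) (skip-< (val-< ρ₂ x<))))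

  h-2 : h 2 ≡ 0
  h-2 = trans (h-suc-suc z<s) (trans (cong (skip A) (val-◂-0 z≤n ρ₁)) (skip-< 1≤A))

  h-3+ : ∀ {x} → x < 2 + K → h (3 + x) ≡ skip A (suc (g x))
  h-3+ x< = trans (h-suc-suc (s≤s x<)) (cong (skip A) (val-◂-suc z≤n ρ₁ x<))

  g-last : g (suc K) ≡ J
  g-last = val-▸-last (id ▸ J≤K) (ℕ.m≤n⇒m≤1+n J≤K)

  g-K : g K ≡ suc J
  g-K = trans (val-▸-< (id ▸ J≤K) (ℕ.m≤n⇒m≤1+n J≤K) ℕ.≤-refl) (trans (cong (skip J) (val-▸-last id J≤K)) (skip-≥ {J} ℕ.≤-refl))

  g-< : ∀ {x} → x < K → g x ≡ skip J (skip J x)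
  g-< x<K = trans (val-▸-< (id ▸ J≤K) (ℕ.m≤n⇒m≤1+n J≤K) (ℕ.m≤n⇒m≤1+n x<K))
    (cong (skip J) (trans (val-▸-< id J≤K x<K) (cong (skip J) (val-id x<K))))

  h-last : h (4 + K) ≡ 2 + J
  h-last = trans (h-3+ ℕ.≤-refl) (trans (cong (λ y → skip A (suc y)) g-last) (skip-≥ A≤1+J))

  h-mono : ∀ {x y} → x < 2 + K → y < 2 + K → g x < g y → h (3 + x) < h (3 + y)
  h-mono x< y< lt = subst₂ _<_ (sym (h-3+ x<)) (sym (h-3+ y<)) (skip-mono A (s≤s lt))

  final-descent : h (4 + K) < h (3 + K)
  final-descent = h-mono ℕ.≤-refl (ℕ.m≤n⇒m≤1+n ℕ.≤-refl) (subst₂ _<_ (sym g-last) (sym g-K) ℕ.≤-refl)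

  up : h 0 < h 1
  up = subst₂ _<_ (sym h-0) (sym h-1) (s≤s (ℕ.≤-trans A≤1+J (s≤s (ℕ.≤-trans J≤K (ℕ.m≤n+m K 2)))))

  down : h 2 < h 0
  down = subst₂ _<_ (sym h-2) (sym h-0) 1≤A

  free : SelfOverlapFree (3 + K) h
  -- Length 2: the pattern begins with an ascent and ends with the descent b+1 b.
  free d zero sum i = ℕ.<-asym final-descent (subst₂ (λ x y → h x < h y) e₀ e₁ (Iso-< (Iso-sym i) z<s (s≤s z<s) up))
    where
    e₁ : suc d + 1 ≡ 4 + K
    e₁ = ℕ.suc-injective (trans (sym (ℕ.+-suc (suc d) 1)) sum)
    e₀ : suc d + 0 ≡ 3 + K
    e₀ = ℕ.suc-injective (trans (sym (ℕ.+-suc (suc d) 0)) e₁)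
  -- Shift 1 would need an ascent to the entry 1, and shift 2 an entry below it.
  free zero (suc c) sum i = ℕ.≤⇒≯ z≤n (subst (h 1 <_) h-2 (Iso-< (Iso-sym i) z<s (s≤s z<s) up))
  free (suc zero) (suc c) sum i = ℕ.≤⇒≯ z≤n (subst (h 4 <_) h-2 (Iso-< (Iso-sym i) (s≤s (s≤s z<s)) z<s down))
  free (suc (suc d)) (suc c) sum i = cases c i total
    where
    total : d + suc (suc c) ≡ suc K
    total = ℕ.suc-injective (trans (sym (ℕ.+-suc d (suc (suc c)))) (ℕ.suc-injective (ℕ.suc-injective (ℕ.suc-injective sum))))

    d<K : d < K
    d<K = ℕ.≤-trans (ℕ.≤-trans (ℕ.≤-reflexive (ℕ.+-comm 1 d)) (ℕ.+-monoʳ-≤ d (s≤s z≤n)))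
      (ℕ.≤-reflexive (ℕ.suc-injective (trans (sym (ℕ.+-suc d (suc c))) total)))

    start : h (3 + d) < h (3 + (d + 1))
    start = subst (λ y → h (3 + y) < h (3 + (d + 1))) (ℕ.+-identityʳ d) (Iso-< (Iso-sym i) z<s (s≤s z<s) up)

    next : h (3 + (d + 2)) < h (3 + d)
    next = subst (λ y → h (3 + (d + 2)) < h (3 + y)) (ℕ.+-identityʳ d) (Iso-< (Iso-sym i) (s≤s (s≤s z<s)) z<s down)

    g-reflect : ∀ {x y} → x < 2 + K → y < 2 + K → h (3 + x) < h (3 + y) → g x < g y
    g-reflect {x} {y} x< y< lt with ℕ.<-cmp (g x) (g y)
    ... | tri< a _ _ = a
    ... | tri≈ _ a _ = contradiction lt (ℕ.<-irrefl (cong (λ x → h (3 + x)) (val-inj ρ₁ x< y< a)))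
    ... | tri> _ _ a = contradiction lt (ℕ.<-asym (h-mono y< x< a))

    cases : ∀ c → Iso (3 + c) (h ∘ (3 + d +_)) h → d + suc (suc c) ≡ suc K → ⊥
    -- Length 3: the last entry of L would lie strictly between b and b+1.
    cases zero _ eq = ℕ.<⇒≱ above below
      where
      d+1 : d + 1 ≡ K
      d+1 = ℕ.suc-injective (trans (sym (ℕ.+-suc d 1)) eq)
      below : g d ≤ J
      below = s≤s⁻¹ (subst (g d <_) g-K (g-reflect (ℕ.m≤n⇒m≤1+n (ℕ.m≤n⇒m≤1+n d<K)) (ℕ.m≤n⇒m≤1+n ℕ.≤-refl)
        (subst (λ y → h (3 + d) < h (3 + y)) d+1 start)))
      above : J < g d
      above = subst (_< g d) g-last (g-reflect ℕ.≤-refl (ℕ.m≤n⇒m≤1+n (ℕ.m≤n⇒m≤1+n d<K))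
        (subst (λ y → h (3 + y) < h (3 + d)) eq next))
    -- Length 4: the third and fourth entries ascend since the third is 1, but the pattern ends with
    -- a descent.
    cases (suc zero) i eq = ℕ.<-asym final-descent (subst₂ (λ y z → h (3 + y) < h (3 + z)) d+2 eq
      (Iso-< (Iso-sym i) (s≤s (s≤s z<s)) (s≤s (s≤s (s≤s z<s))) (subst (_< h 3) (sym h-2) (ℕ.n≢0⇒n>0 λ h-3 →
        case val-inj ρ (s≤s (s≤s (s≤s z<s))) (s≤s (s≤s z<s)) (trans h-3 (sym h-2)) of λ ()))))
      where
      d+2 : d + 2 ≡ K
      d+2 = ℕ.suc-injective (trans (sym (ℕ.+-suc d 2)) eq)
    -- Length at least 5: the copy of 231 lies inside L, which is increasing.
    cases (suc (suc c)) _ eq = ℕ.<-asym next (h-mono (ℕ.m≤n⇒m≤1+n (ℕ.m≤n⇒m≤1+n d<K)) (ℕ.m≤n⇒m≤1+n (ℕ.m≤n⇒m≤1+n d+2<K))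
      (subst₂ _<_ (sym (g-< d<K)) (sym (g-< d+2<K)) (skip-mono J (skip-mono J (ℕ.m<m+n d z<s)))))
      where
      d+2<K : d + 2 < K
      d+2<K = ℕ.≤-trans (ℕ.≤-trans (ℕ.≤-reflexive (sym (ℕ.+-suc d 2))) (ℕ.+-monoʳ-≤ d (s≤s (s≤s (s≤s (z≤n {c}))))))
        (ℕ.≤-reflexive (ℕ.suc-injective (trans (sym (ℕ.+-suc d (3 + c))) eq)))

-- Conclusion

-- For m = 4 no permutation with end entries 2 and 3 is non-overlapping, but the number of
-- ways of linking two copies tells this case apart from the others.
private
  π₂₃ π₁₂ π₁₃ : Permutation′ 4
  π₂₃ = insert zero (suc zero) (insert (fromℕ 2) (suc zero) id)
  π₁₂ = insert (fromℕ 3) (suc zero) id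
  π₁₃ = insert (fromℕ 3) (suc (suc zero)) id

  -- With A and B the 0-based end entries, B entries of one copy and A of the other interleave below
  -- the shared entry, the rest above it: binom(A+B, A) binom(2M-A-B, M-A) ways. For M = 3 this is
  -- 9, 10 and 4 in the three cases; the proofs evaluate the sum over the permutations of 7
  -- elements.
  count₂₃ : N-chain 2 (val π₂₃) 2 ≡ pos 9
  count₂₃ = N-chain-def 2 (val π₂₃) 2

  count₁₂ : N-chain 2 (val π₁₂) 2 ≡ pos 10
  count₁₂ = N-chain-def 2 (val π₁₂) 2

  count₁₃ : N-chain 2 (val π₁₃) 2 ≡ pos 4
  count₁₃ = N-chain-def 2 (val π₁₃) 2

data Ends (M′ A B : ℕ) : Set where
  extreme     : A ≡ 0 → B ≡ suc M′ → Ends M′ A B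
  generic     : B < suc M′ → Representative M′ A B → Ends M′ A B
  exceptional : M′ ≡ 2 → A ≡ 1 → B ≡ 2 → Ends M′ A B

ends : ∀ M′ A B → A < B → A + B ≤ suc M′ → Ends M′ A B
ends M′ zero B 0<B B≤M with ℕ.m≤n⇒m<n∨m≡n B≤M
... | inj₁ B<M = generic B<M (increasing-representative M′ B 0<B B<M)
... | inj₂ B≡M = extreme refl B≡M
ends M′ (suc A) (suc (suc J)) (s≤s (s≤s A≤J)) (s≤s le) with ℕ.m≤n⇒∃[o]m+o≡n (ℕ.m+n≤o⇒n≤o A le)
-- The shape a m 1 L b+1 b requires b + 1 < m, which is what o > 0 provides.
... | suc o , refl = generic (s≤s (ℕ.m+n≤o⇒n≤o A le)) (subst (λ M′ → Representative M′ (suc A) (2 + J)) (sym (cong (2 +_) (ℕ.+-suc J o)))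
  (central-representative (J + o) (suc A) J (s≤s z≤n) (s≤s A≤J) (ℕ.m≤m+n J o)))
-- Here b = m - 1, and then A + B ≤ M forces a = 2.
... | zero , refl rewrite ℕ.+-identityʳ J with ℕ.n≤0⇒n≡0 (ℕ.+-cancelʳ-≤ (2 + J) A 0 le) | J
...   | refl | zero  = exceptional refl refl refl
...   | refl | suc K = generic ℕ.≤-refl (edge-representative K)

module _ (σ : Permutation′ 4) where

  exceptional⇒9 : val σ 0 ≡ 1 → val σ 3 ≡ 2 → N-chain 2 (val σ) 2 ≡ pos 9
  exceptional⇒9 a b = trans (N-chain-ends σ π₂₃ a b 2) count₂₃

  -- For m = 4 the ends in standard form with last entry below 4 are (1, 2), (1, 3) and (2, 3), with
  -- the distinct counts 10, 4 and 9.
  9⇒exceptional : val σ 0 < val σ 3 → val σ 0 + val σ 3 ≤ 3 → val σ 3 < 3 → N-chain 2 (val σ) 2 ≡ pos 9 →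
                  val σ 0 ≡ 1 × val σ 3 ≡ 2
  9⇒exceptional A<B A+B≤3 B<3 nine = cases _ _ refl refl A<B A+B≤3 B<3
    where
    cases : ∀ A B → val σ 0 ≡ A → val σ 3 ≡ B → A < B → A + B ≤ 3 → B < 3 → A ≡ 1 × B ≡ 2
    cases 0 1 a b _ _ _ = case trans (sym nine) (trans (N-chain-ends σ π₁₂ a b 2) count₁₂) of λ ()
    cases 0 2 a b _ _ _ = case trans (sym nine) (trans (N-chain-ends σ π₁₃ a b 2) count₁₃) of λ ()
    cases 1 2 _ _ _ _ _ = refl , refl
    cases 0 (suc (suc (suc B))) _ _ _ _ (s≤s (s≤s (s≤s ())))
    cases 1 1 _ _ (s≤s ()) _ _
    cases 1 (suc (suc (suc B))) _ _ _ (s≤s (s≤s (s≤s ()))) _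
    cases (suc (suc A)) (suc (suc (suc B))) _ _ _ _ (s≤s (s≤s (s≤s ())))
    cases (suc (suc A)) 2 _ _ (s≤s (s≤s ())) _ _
    cases (suc (suc A)) 1 _ _ (s≤s ()) _ _

module _ {M′ : ℕ} (π τ : Permutation′ (2 + M′)) where

  N-chain⇒cWilf : SelfOverlapFree M′ (val π) → SelfOverlapFree M′ (val τ) →
                  (∀ k → N-chain M′ (val π) k ≡ N-chain M′ (val τ) k) → CWilfEquivalent π τ
  N-chain⇒cWilf π-free τ-free eq = F⇒cWilf π τ
    (C⇒F (suc M′) (val π) (val τ) -1ℤ (N-chain⇒C M′ π-free τ-free eq -1ℤ))

  strong⇒N-chain : StronglyCWilfEquivalent π τ → ∀ k → N-chain M′ (val π) k ≡ N-chain M′ (val τ) k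
  strong⇒N-chain eq = C⇒N-chain M′ λ t → F⇒C (suc M′) (val π) (val τ) t (strong⇒F π τ eq t)

lastEntry≡ : ∀ {M} (π : Permutation′ (suc M)) → lastEntry π ≡ suc (val π M)
lastEntry≡ {M} π = cong suc (trans (sym (val-toℕ π (fromℕ M))) (cong (val π) (Fin.toℕ-fromℕ M)))

theorem1p8 : (∀ (m : ℕ) .{{_ : NonZero m}} (π τ : Permutation′ m) →
    NonOverlapping π → NonOverlapping τ →
    StandardForm π → StandardForm τ →
    CWilfEquivalent π τ →
    firstEntry π ≡ firstEntry τ × lastEntry π ≡ lastEntry τ) →
    (∀ (m : ℕ) .{{_ : NonZero m}} (π τ : Permutation′ m) →
    StandardForm π → StandardForm τ →
    StronglyCWilfEquivalent π τ →
    firstEntry π ≡ firstEntry τ × lastEntry π ≡ lastEntry τ)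
theorem1p8 conjecture (suc zero) π τ (lt , _) _ _ = contradiction lt (ℕ.<-irrefl refl)
theorem1p8 conjecture (suc (suc M′)) π τ π-std τ-std strong = conclusion (classify π π-std) (classify τ τ-std)
  where
  M : ℕ
  M = suc M′

  A<B : ∀ π → StandardForm π → val π 0 < val π M
  A<B π (lt , _) = s<s⁻¹ (subst (suc (val π 0) <_) (lastEntry≡ π) lt)

  A+B≤M : ∀ π → StandardForm π → val π 0 + val π M ≤ M
  A+B≤M π (_ , le) = s≤s⁻¹ (s≤s⁻¹ (subst₂ _≤_
    (cong suc (ℕ.+-suc (val π 0) (val π M))) (ℕ.+-comm (suc M) 1)
    (subst (λ b → suc (val π 0) + b ≤ suc M + 1) (lastEntry≡ π) le)))

  classify : ∀ π → StandardForm π → Ends M′ (val π 0) (val π M)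
  classify π std = ends M′ _ _ (A<B π std) (A+B≤M π std)

  chains : ∀ k → N-chain M′ (val π) k ≡ N-chain M′ (val τ) k
  chains = strong⇒N-chain π τ strong

  entries : val π 0 ≡ val τ 0 → val π M ≡ val τ M → firstEntry π ≡ firstEntry τ × lastEntry π ≡ lastEntry τ
  entries a b = cong suc a , trans (lastEntry≡ π) (trans (cong suc b) (sym (lastEntry≡ τ)))

  interior : ∀ ρ → StandardForm ρ → val ρ M < M → pos 2 ≤ᶻ N-chain M′ (val ρ) 2
  interior ρ std B<M = N-chain-2-interior ρ (ℕ.<-trans (A<B ρ std) B<M) B<M

  clash₂ : ∀ {x y : ℤ} → x ≤ᶻ 1ℤ → pos 2 ≤ᶻ y → x ≡ y → ⊥
  clash₂ x≤1 2≤y refl = case ℤ.≤-trans 2≤y x≤1 of λ { (+≤+ (s≤s ())) }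

  B<M-exceptional : ∀ ρ → M′ ≡ 2 → val ρ M ≡ 2 → val ρ M < M
  B<M-exceptional ρ refl b = subst (_< 3) (sym b) ℕ.≤-refl

  StandardForm-resp : ∀ {ρ σ : Permutation′ (suc M)} → val ρ 0 ≡ val σ 0 → val ρ M ≡ val σ M → StandardForm σ → StandardForm ρ
  StandardForm-resp {ρ} {σ} a b = subst₂ (λ x y → x < y × x + y ≤ suc M + 1)
    (cong suc (sym a)) (trans (lastEntry≡ σ) (trans (cong suc (sym b)) (sym (lastEntry≡ ρ))))

  conclusion : Ends M′ (val π 0) (val π M) → Ends M′ (val τ 0) (val τ M) →
               firstEntry π ≡ firstEntry τ × lastEntry π ≡ lastEntry τ
  conclusion (extreme a b)       (extreme a′ b′)       = entries (trans a (sym a′)) (trans b (sym b′))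
  conclusion (extreme a b)       (generic B<M _)       = ⊥-elim (clash₂ (N-chain-2-extreme π a b) (interior τ τ-std B<M) (chains 2))
  conclusion (extreme a b)       (exceptional m a′ b′) = ⊥-elim (clash₂ (N-chain-2-extreme π a b) (interior τ τ-std (B<M-exceptional τ m b′)) (chains 2))
  conclusion (generic B<M _)     (extreme a b)         = ⊥-elim (clash₂ (N-chain-2-extreme τ a b) (interior π π-std B<M) (sym (chains 2)))
  conclusion (exceptional m _ b) (extreme a′ b′)       = ⊥-elim (clash₂ (N-chain-2-extreme τ a′ b′) (interior π π-std (B<M-exceptional π m b)) (sym (chains 2)))
  conclusion (exceptional _ a b) (exceptional _ a′ b′) = entries (trans a (sym a′)) (trans b (sym b′))
  conclusion (generic _ (π′ , a , b , π-free)) (generic _ (τ′ , a′ , b′ , τ-free)) =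
    let first , last = conjecture (suc M) π′ τ′
          (SelfOverlapFree⇒NonOverlapping π′ π-free) (SelfOverlapFree⇒NonOverlapping τ′ τ-free)
          (StandardForm-resp {π′} {π} a b π-std) (StandardForm-resp {τ′} {τ} a′ b′ τ-std)
          (N-chain⇒cWilf π′ τ′ π-free τ-free λ k →
            trans (N-chain-ends π′ π a b k) (trans (chains k) (sym (N-chain-ends τ′ τ a′ b′ k))))
    in entries (trans (sym a) (trans (ℕ.suc-injective first) a′))
         (trans (sym b) (trans (ℕ.suc-injective (trans (sym (lastEntry≡ π′)) (trans last (lastEntry≡ τ′)))) b′))
  conclusion (exceptional refl a b) (generic B<M _) =
    let a′ , b′ = 9⇒exceptional τ (A<B τ τ-std) (A+B≤M τ τ-std) B<M (trans (sym (chains 2)) (exceptional⇒9 π a b))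
    in entries (trans a (sym a′)) (trans b (sym b′))
  conclusion (generic B<M _) (exceptional refl a b) =
    let a′ , b′ = 9⇒exceptional π (A<B π π-std) (A+B≤M π π-std) B<M (trans (chains 2) (exceptional⇒9 τ a b))
    in entries (trans a′ (sym a)) (trans b′ (sym b))
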